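{- Let $R$ be a finite Frobenius ring and $w$ a homogeneous weight on $R$ with average value $\gamma>0$, extended additively to $R^n$. Let $C\leq {}_RR^n$ be a nonzero linear code of length $n$ and minimum homogeneous weight $d$ with $\gamma n\leq d$, and whose minimum Hamming weight is less than $n$. Let $P:=\max\{|Rc| : c\in C,\ \ell(c)<n\}$. Then $$n-\left\lceil \frac{P-1}{P}\,\frac{d}{\gamma}\right\rceil \;\geq\; \left\lceil \log_P|C|-\log_P|R|\right\rceil.$$
   Context: A finite ring $R$ (with identity) is Frobenius if the character group of $(R,+)$ is isomorphic to $R$ as a left $R$-module (equivalently, $R$ has a character whose kernel contains no nonzero left or right ideal). A function $w:R\to\mathbb{R}$ is a homogeneous weight with average value $\gamma$ if $w(0)=0$, $w(x)=w(y)$ whenever $Rx=Ry$, and $\sum_{y\in Rx} w(y)=\gamma|Rx|$ for all nonzero $x\in R$; on $R^n$, $w(c)=\sum_i w(c_i)$. Minimum homogeneous (resp. Hamming) weight of a code is the minimum of $w$ (resp. of the number of nonzero coordinates) over its nonzero words. $\ell(c)$ denotes the Hamming weight (number of nonzero coordinates) of $c$.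
   Formalization: The homogeneous weight w, its average value γ and the minimum homogeneous weight d are taken to be rational instead of real. -}

module Defs where

open import Level using (0ℓ)
open import Algebra.Bundles using (Ring)
open import Data.Nat as ℕ using (ℕ; zero; suc; NonZero)
import Data.Nat.Properties as ℕP
open import Data.Integer as ℤ using (ℤ; +_; -[1+_])
open import Data.Integer.Divisibility as ℤd using ()
open import Data.Rational as ℚ using (ℚ)
open import Data.List as List using (List; []; _∷_; length; filter)
open import Data.List.Relation.Unary.Any using (Any; any?)
open import Data.List.Relation.Unary.AllPairs using (AllPairs)
open import Data.Vec as Vec using (Vec; []; _∷_)
open import Data.Product using (Σ; _×_; ∃; _,_)
open import Relation.Nullary using (¬_; Dec; yes; no)
open import Relation.Unary using (Pred; Decidable)
open import Relation.Binary using () renaming (Decidable to Decidable₂)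

record FiniteRing : Set₁ where
  field
    ring     : Ring 0ℓ 0ℓ
  open Ring ring public
  field
    _≟_      : Decidable₂ _≈_
    elems    : List Carrier
    complete : ∀ x → Any (x ≈_) elems
    distinct : AllPairs (λ x y → ¬ (x ≈ y)) elems

module _ (R : FiniteRing) where
  open FiniteRing R

  card : ℕ
  card = length elems

  countR : {P : Pred Carrier 0ℓ} → Decidable P → ℕ
  countR P? = length (filter P? elems)

  InRx : Carrier → Pred Carrier 0ℓ
  InRx x y = ∃ λ r → y ≈ r * x

  InRx? : (x : Carrier) → Decidable (InRx x)
  InRx? x y with any? (λ r → y ≟ (r * x)) elems
  ... | yes p = yes (wit p)
    where
    wit : ∀ {xs} → Any (λ r → y ≈ r * x) xs → InRx x y
    wit (Any.here q) = _ , q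
    wit (Any.there q) = wit q
  ... | no ¬p = no (λ { (r , q) → ¬p (lift r q (complete r)) })
    where
    lift : ∀ {xs} r → y ≈ r * x → Any (r ≈_) xs → Any (λ s → y ≈ s * x) xs
    lift r q (Any.here e) = Any.here (trans q (*-congʳ e))
    lift r q (Any.there a) = Any.there (lift r q a)

  cardRx : Carrier → ℕ
  cardRx x = countR (InRx? x)

  sumRx : (Carrier → ℚ) → Carrier → ℚ
  sumRx w x = List.foldr (λ y s → w y ℚ.+ s) 0ℚ' (filter (InRx? x) elems)
    where 0ℚ' = ℚ.0ℚ

  -- Frobenius.  A character of the finite abelian group (R,+) takes values
  -- in the |R|-th roots of unity, i.e. is an additive map R → ℤ/|R|ℤ; we
  -- represent it by χ : R → ℤ, read modulo |R|.

  _≡[mod]_ : ℤ → ℤ → Set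
  a ≡[mod] b = (+ card) ℤd.∣ (a ℤ.- b)

  IsCharacter : (Carrier → ℤ) → Set
  IsCharacter χ = (∀ x y → x ≈ y → χ x ≡[mod] χ y)
                × (∀ x y → χ (x + y) ≡[mod] (χ x ℤ.+ χ y))

  record IsLeftIdeal (I : Pred Carrier 0ℓ) : Set where
    field
      resp  : ∀ {x y} → x ≈ y → I x → I y
      has0  : I 0#
      +-cl  : ∀ {x y} → I x → I y → I (x + y)
      *-cl  : ∀ r {x} → I x → I (r * x)

  record IsRightIdeal (I : Pred Carrier 0ℓ) : Set where
    field
      resp  : ∀ {x y} → x ≈ y → I x → I y
      has0  : I 0#
      +-cl  : ∀ {x y} → I x → I y → I (x + y)
      *-cl  : ∀ r {x} → I x → I (x * r)

  Nonzero : Pred Carrier 0ℓ → Set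
  Nonzero I = ∃ λ x → I x × ¬ (x ≈ 0#)

  KerContains : (Carrier → ℤ) → Pred Carrier 0ℓ → Set
  KerContains χ I = ∀ x → I x → χ x ≡[mod] (+ 0)

  IsFrobenius : Set₁
  IsFrobenius = ∃ λ (χ : Carrier → ℤ) → IsCharacter χ
    × (∀ I → IsLeftIdeal I → Nonzero I → ¬ KerContains χ I)
    × (∀ I → IsRightIdeal I → Nonzero I → ¬ KerContains χ I)

  SameLeftIdeal : Carrier → Carrier → Set
  SameLeftIdeal x y = ∀ z → (InRx x z → InRx y z) × (InRx y z → InRx x z)

  IsHomogeneousWeight : (Carrier → ℚ) → ℚ → Set
  IsHomogeneousWeight w γ =
      (w 0# ≡ ℚ.0ℚ)
    × (∀ x y → SameLeftIdeal x y → w x ≡ w y)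
    × (∀ x → ¬ (x ≈ 0#) → sumRx w x ≡ γ ℚ.* (+ cardRx x ℚ./ 1))
    where open import Relation.Binary.PropositionalEquality using (_≡_)

  Word : ℕ → Set
  Word n = Vec Carrier n

  _≈ᵥ_ : ∀ {n} → Word n → Word n → Set
  [] ≈ᵥ [] = Data.Unit.⊤ where import Data.Unit
  (x ∷ xs) ≈ᵥ (y ∷ ys) = (x ≈ y) × (xs ≈ᵥ ys)

  _≟ᵥ_ : ∀ {n} → Decidable₂ (_≈ᵥ_ {n})
  [] ≟ᵥ [] = yes _
  (x ∷ xs) ≟ᵥ (y ∷ ys) with x ≟ y | xs ≟ᵥ ys
  ... | yes p | yes q = yes (p , q)
  ... | no ¬p | _ = no (λ { (p , _) → ¬p p })
  ... | yes _ | no ¬q = no (λ { (_ , q) → ¬q q })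

  zeroᵥ : ∀ n → Word n
  zeroᵥ n = Vec.replicate n 0#

  _+ᵥ_ : ∀ {n} → Word n → Word n → Word n
  _+ᵥ_ = Vec.zipWith _+_

  _·ᵥ_ : ∀ {n} → Carrier → Word n → Word n
  r ·ᵥ c = Vec.map (r *_) c

  allWords : ∀ n → List (Word n)
  allWords zero = [] ∷ []
  allWords (suc n) = List.concatMap (λ x → List.map (x ∷_) (allWords n)) elems

  record IsLinearCode (n : ℕ) (C : Pred (Word n) 0ℓ) : Set where
    field
      resp  : ∀ {c c'} → c ≈ᵥ c' → C c → C c'
      has0  : C (zeroᵥ n)
      +-cl  : ∀ {c c'} → C c → C c' → C (c +ᵥ c')
      ·-cl  : ∀ r {c} → C c → C (r ·ᵥ c)

  cardCode : ∀ {n} {C : Pred (Word n) 0ℓ} → Decidable C → ℕ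
  cardCode {n} C? = length (filter C? (allWords n))

  InRc : ∀ {n} → Word n → Pred (Word n) 0ℓ
  InRc c v = ∃ λ r → v ≈ᵥ (r ·ᵥ c)

  InRc? : ∀ {n} (c : Word n) → Decidable (InRc c)
  InRc? c v with any? (λ r → v ≟ᵥ (r ·ᵥ c)) elems
  ... | yes p = yes (wit p)
    where
    wit : ∀ {xs} → Any (λ r → v ≈ᵥ (r ·ᵥ c)) xs → InRc c v
    wit (Any.here q) = _ , q
    wit (Any.there q) = wit q
  ... | no ¬p = no (λ { (r , q) → ¬p (lift r q (complete r)) })
    where
    lem : ∀ {m} r s (d u : Word m) → u ≈ᵥ (r ·ᵥ d) → r ≈ s → u ≈ᵥ (s ·ᵥ d)
    lem r s [] [] q e = q
    lem r s (d ∷ ds) (u ∷ us) (q , qs) e = trans q (*-congʳ e) , lem r s ds us qs e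
    lift : ∀ {xs} r → v ≈ᵥ (r ·ᵥ c) → Any (r ≈_) xs → Any (λ s → v ≈ᵥ (s ·ᵥ c)) xs
    lift r q (Any.here e) = Any.here (lem r _ c v q e)
    lift r q (Any.there a) = Any.there (lift r q a)

  cardRc : ∀ {n} → Word n → ℕ
  cardRc {n} c = length (filter (InRc? c) (allWords n))

  hamming : ∀ {n} → Word n → ℕ
  hamming [] = 0
  hamming (x ∷ xs) with x ≟ 0#
  ... | yes _ = hamming xs
  ... | no _  = suc (hamming xs)

  weightᵥ : (Carrier → ℚ) → ∀ {n} → Word n → ℚ
  weightᵥ w [] = ℚ.0ℚ
  weightᵥ w (x ∷ xs) = w x ℚ.+ weightᵥ w xs

  NonzeroWord : ∀ {n} → Word n → Set
  NonzeroWord {n} c = ¬ (c ≈ᵥ zeroᵥ n)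

powℤ : (P : ℕ) → .{{NonZero P}} → ℤ → ℚ
powℤ P (+ m) = (+ (P ℕ.^ m)) ℚ./ 1
powℤ P -[1+ m ] = (+ 1) ℚ./ (P ℕ.^ suc m)
  where instance _ = ℕP.m^n≢0 P (suc m)

-- k = ⌈ log_P x ⌉   ⇔   P^(k-1) < x ≤ P^k   (for P ≥ 2, x > 0)
IsCeilLog : (P : ℕ) → .{{NonZero P}} → ℚ → ℤ → Set
IsCeilLog P x k = (powℤ P (k ℤ.- + 1) ℚ.< x) × (x ℚ.≤ powℤ P k)

card-nonZero : (R : FiniteRing) → NonZero (card R)
card-nonZero R = go (FiniteRing.complete R (FiniteRing.0# R))
  where
  go : ∀ {xs} → Any (FiniteRing._≈_ R (FiniteRing.0# R)) xs → NonZero (length xs)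
  go {_ ∷ _} _ = _

-- Let c ∈ C have a zero coordinate j and |Rc| = P, and let C′ be the subcode of words vanishing at j,
-- N = |C′|.  Then |C| ≤ |R|N, and Rc ≤ C′ gives N = Pt by Lagrange.
--
-- Over a Frobenius ring a homogeneous weight has average γ on every nonzero left ideal, not only on
-- the principal ones: with the generating character χ one builds ε = ψ ∘ χ : R → ℚ with ε(0) = 1 whose
-- sum over every nonzero left ideal vanishes, so γ − w − γε sums to zero over each Rx, hence over each union of
-- such ideals.  Averaging the weight of C′ coordinatewise now yields the Plotkin bound
-- (N − 1)d ≤ γN(n − 1).  With γn ≤ d it gives N ≤ n, and then (P − 1)d/(Pγ) ≤ n − t because
--   P(n − t)(N − 1) − (P − 1)N(n − 1) = P(t − 1)(n − N) ≥ 0.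
-- Finally |C|/|R| ≤ Pt ≤ P^t shows that ⌈log_P(|C|/|R|)⌉ ≤ t.

module Submission where

open import Defs
open import Level using (0ℓ)
open import Function using (_∘_; id; case_of_)
open import Algebra.Bundles using (AbelianGroup)
open import Data.Bool using (if_then_else_)
open import Data.Empty using (⊥)
open import Data.Fin as Fin using (Fin)
import Data.Fin.Properties as FinP
open import Data.Nat as ℕ using (ℕ; NonZero; _∸_; zero; suc)
import Data.Nat.Properties as ℕP
open import Data.Nat.Divisibility as ℕD using (_∣_; _∣?_; divides)
open import Data.Integer as ℤ using (ℤ; +_)
import Data.Integer.Properties as ℤP
import Data.Integer.DivMod as ℤD
import Data.Integer.Divisibility.Signed as ℤS
open import Data.Integer.Tactic.RingSolver using (solve-∀)
open import Data.Rational as ℚ using (ℚ; 0ℚ; 1ℚ; _+_; _*_; _-_; -_; _≤_; _<_)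
import Data.Rational.Properties as ℚP
import Data.Rational.Unnormalised as ℚᵘ
import Data.Rational.Unnormalised.Properties as ℚᵘP
open import Data.Rational.Solver using (module +-*-Solver)
open +-*-Solver using (solve; _:=_; _:+_; _:*_; _:-_; :-_; con)
open import Data.List as List using (List; []; _∷_; _++_; length; filter; upTo; allFin)
open import Data.List.Properties using (length-filter; length-tabulate; map-tabulate)
open import Data.List.Membership.Propositional.Properties using (∈-upTo⁺; ∈-upTo⁻; ∈-allFin)
open import Data.List.Relation.Unary.All as All using (All; []; _∷_)
open import Data.List.Relation.Unary.AllPairs using (AllPairs; []; _∷_)
open import Data.List.Relation.Unary.Any as Any using (Any; here; there; any?)
open import Data.List.Relation.Unary.Unique.Propositional.Properties using (upTo⁺; allFin⁺)
open import Data.List.Relation.Unary.Unique.DecSetoid.Properties using (deduplicate-!)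
open import Data.List.Membership.Setoid.Properties using (∈-deduplicate⁺)
open import Data.Product using (∃; _×_; _,_; proj₁; proj₂)
open import Data.Vec as Vec using (Vec; []; _∷_)
open import Data.Vec.Properties using (lookup-map; lookup-replicate; lookup-zipWith)
open import Data.Nat.Induction using (<-wellFounded)
open import Induction.WellFounded using (Acc; acc)
open import Relation.Binary using (DecSetoid; _Respects_) renaming (Decidable to Decidable₂)
open import Relation.Binary.PropositionalEquality
  using (_≡_; refl; sym; trans; cong; cong₂; subst; subst₂; decSetoid; module ≡-Reasoning)
open import Relation.Nullary using (¬_; Dec; yes; no; does; ¬?; _×-dec_; contradiction)
open import Relation.Nullary.Decidable using (map′; decidable-stable)
open import Relation.Unary using (Pred; Decidable; _⊆_)

-- Over a Frobenius ring the classical formula writes a homogeneous weight as γ times 1 minus the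
-- average of χ(xu) over the units u, with complex character values. Only sums over left ideals
-- matter here, so χ may instead be followed by any rational function ψ on the residues modulo |R|
-- with ψ(0) = 1 whose sum over every nonzero subgroup of ℤ/|R| vanishes. The image of a nonzero
-- left ideal under χ is such a subgroup because the kernel of χ contains no nonzero left ideal.
-- Thus no roots of unity enter.
--
-- The obstacle is that projecting a code to one coordinate yields a left ideal that need not be
-- principal, whereas the hypothesis on `w` speaks of principal ones only. Passing from principal
-- ideals to all of them removes one class of generators at a time, and what is left is closed under
-- left multiplication but in general not under addition. The induction therefore runs over such
-- sets and not over ideals.
--
-- The subcode C′ plays two roles: its dead coordinate turns n into n - 1 in the averaging, which is
-- what forces N ≤ n, and its containing Rc makes N a multiple of P.

private variable
  A B : Set

-- Rational sums over lists and indicator functions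

∑ : List A → (A → ℚ) → ℚ
∑ []       f = 0ℚ
∑ (x ∷ xs) f = f x + ∑ xs f

⟦_⟧ : Dec A → ℚ
⟦ a? ⟧ = if does a? then 1ℚ else 0ℚ

⟦⟧-yes : (a? : Dec A) → A → ⟦ a? ⟧ ≡ 1ℚ
⟦⟧-yes (yes _) _ = refl
⟦⟧-yes (no ¬a) a = contradiction a ¬a

⟦⟧-no : (a? : Dec A) → ¬ A → ⟦ a? ⟧ ≡ 0ℚ
⟦⟧-no (no _)  _  = refl
⟦⟧-no (yes a) ¬a = contradiction a ¬a

⟦⟧-cong : (a? : Dec A) (b? : Dec B) → (A → B) → (B → A) → ⟦ a? ⟧ ≡ ⟦ b? ⟧
⟦⟧-cong (yes a) b? f g = sym (⟦⟧-yes b? (f a))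
⟦⟧-cong (no ¬a) b? f g = sym (⟦⟧-no b? (¬a ∘ g))

⟦⟧-×-dec : (a? : Dec A) (b? : Dec B) → ⟦ a? ×-dec b? ⟧ ≡ ⟦ a? ⟧ * ⟦ b? ⟧
⟦⟧-×-dec (yes _) b? = sym (ℚP.*-identityˡ ⟦ b? ⟧)
⟦⟧-×-dec (no _)  b? = sym (ℚP.*-zeroˡ ⟦ b? ⟧)

⟦⟧-split : (a? : Dec A) (b? : Dec B) → (B → A) → ⟦ a? ⟧ ≡ ⟦ a? ×-dec ¬? b? ⟧ + ⟦ b? ⟧
⟦⟧-split (yes a) (yes b) f = refl
⟦⟧-split (yes a) (no ¬b) f = refl
⟦⟧-split (no ¬a) (yes b) f = contradiction (f b) ¬a
⟦⟧-split (no ¬a) (no ¬b) f = refl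

⟦⟧-guard : (a? : Dec A) {p q : ℚ} → (A → p ≡ q) → ⟦ a? ⟧ * p ≡ ⟦ a? ⟧ * q
⟦⟧-guard (yes a) f = cong (1ℚ *_) (f a)
⟦⟧-guard (no _) {p} {q} f = trans (ℚP.*-zeroˡ p) (sym (ℚP.*-zeroˡ q))

∑-cong : (xs : List A) {f g : A → ℚ} → (∀ x → f x ≡ g x) → ∑ xs f ≡ ∑ xs g
∑-cong []       f≗g = refl
∑-cong (x ∷ xs) f≗g = cong₂ _+_ (f≗g x) (∑-cong xs f≗g)

∑-mono : (xs : List A) {f g : A → ℚ} → (∀ x → f x ≤ g x) → ∑ xs f ≤ ∑ xs g
∑-mono []       f≤g = ℚP.≤-refl
∑-mono (x ∷ xs) f≤g = ℚP.+-mono-≤ (f≤g x) (∑-mono xs f≤g)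

∑-zero : (xs : List A) {f : A → ℚ} → (∀ x → f x ≡ 0ℚ) → ∑ xs f ≡ 0ℚ
∑-zero []       f≗0 = refl
∑-zero (x ∷ xs) f≗0 = cong₂ _+_ (f≗0 x) (∑-zero xs f≗0)

∑-+ : (xs : List A) (f g : A → ℚ) → ∑ xs (λ x → f x + g x) ≡ ∑ xs f + ∑ xs g
∑-+ []       f g = refl
∑-+ (x ∷ xs) f g = trans (cong (λ s → f x + g x + s) (∑-+ xs f g))
  (solve 4 (λ a b c d → (a :+ b) :+ (c :+ d) := (a :+ c) :+ (b :+ d)) refl
    (f x) (g x) (∑ xs f) (∑ xs g))

∑-*ˡ : (xs : List A) (c : ℚ) (f : A → ℚ) → ∑ xs (λ x → c * f x) ≡ c * ∑ xs f
∑-*ˡ []       c f = sym (ℚP.*-zeroʳ c)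
∑-*ˡ (x ∷ xs) c f = trans (cong (λ s → c * f x + s) (∑-*ˡ xs c f)) (sym (ℚP.*-distribˡ-+ c (f x) (∑ xs f)))

∑-*ʳ : (xs : List A) (f : A → ℚ) (c : ℚ) → ∑ xs (λ x → f x * c) ≡ ∑ xs f * c
∑-*ʳ xs f c = trans (∑-cong xs (λ x → ℚP.*-comm (f x) c)) (trans (∑-*ˡ xs c f) (ℚP.*-comm c _))

∑-swap : (xs : List A) (ys : List B) (f : A → B → ℚ) →
         ∑ xs (λ x → ∑ ys (f x)) ≡ ∑ ys (λ y → ∑ xs (λ x → f x y))
∑-swap []       ys f = sym (∑-zero ys (λ _ → refl))
∑-swap (x ∷ xs) ys f = trans (cong (λ s → ∑ ys (f x) + s) (∑-swap xs ys f)) (sym (∑-+ ys (f x) _))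

∑-++ : (xs ys : List A) (f : A → ℚ) → ∑ (xs ++ ys) f ≡ ∑ xs f + ∑ ys f
∑-++ []       ys f = sym (ℚP.+-identityˡ _)
∑-++ (x ∷ xs) ys f = trans (cong (λ s → f x + s) (∑-++ xs ys f)) (sym (ℚP.+-assoc (f x) _ _))

∑-map : (g : A → B) (xs : List A) (f : B → ℚ) → ∑ (List.map g xs) f ≡ ∑ xs (f ∘ g)
∑-map g []       f = refl
∑-map g (x ∷ xs) f = cong (λ s → f (g x) + s) (∑-map g xs f)

∑-concatMap : (g : A → List B) (xs : List A) (f : B → ℚ) →
              ∑ (List.concatMap g xs) f ≡ ∑ xs (λ x → ∑ (g x) f)
∑-concatMap g []       f = refl
∑-concatMap g (x ∷ xs) f = trans (∑-++ (g x) _ f) (cong (λ s → ∑ (g x) f + s) (∑-concatMap g xs f))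

∑-filter : {P : Pred A 0ℓ} (P? : Decidable P) (xs : List A) (f : A → ℚ) →
           List.foldr (λ y s → f y + s) 0ℚ (filter P? xs) ≡ ∑ xs (λ x → ⟦ P? x ⟧ * f x)
∑-filter P? []       f = refl
∑-filter P? (x ∷ xs) f with P? x
... | yes _ = cong₂ _+_ (sym (ℚP.*-identityˡ (f x))) (∑-filter P? xs f)
... | no  _ = trans (∑-filter P? xs f)
                (sym (trans (cong (λ s → s + _) (ℚP.*-zeroˡ (f x))) (ℚP.+-identityˡ _)))

-- This turns "each class occurs exactly once in the list" into an identity between sums, so that
-- later reindexing is a double sum rather than a permutation of lists. The relation is left general
-- because it is also used for cosets.
∑-indicator : {_~_ : A → A → Set} (_~?_ : Decidable₂ _~_) →
              (∀ {x y} → x ~ y → y ~ x) → (∀ {x y z} → x ~ y → y ~ z → x ~ z) →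
              (xs : List A) (a : A) → AllPairs (λ x y → ¬ (x ~ y)) xs → Any (a ~_) xs →
              ∑ xs (λ x → ⟦ x ~? a ⟧) ≡ 1ℚ
∑-indicator {_~_ = _~_} _~?_ sy tr (x ∷ xs) a (d ∷ ds) (here p) =
  cong₂ _+_ (⟦⟧-yes (x ~? a) (sy p)) (rest xs d)
  where
  rest : ∀ ys → All (λ y → ¬ (x ~ y)) ys → ∑ ys (λ y → ⟦ y ~? a ⟧) ≡ 0ℚ
  rest []       []       = refl
  rest (y ∷ ys) (e ∷ es) = cong₂ _+_ (⟦⟧-no (y ~? a) (λ q → e (sy (tr q p)))) (rest ys es)
∑-indicator {_~_ = _~_} _~?_ sy tr (x ∷ xs) a (d ∷ ds) (there p) =
  cong₂ _+_ (⟦⟧-no (x ~? a) (λ q → absurd xs d p q)) (∑-indicator _~?_ sy tr xs a ds p)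
  where
  absurd : ∀ ys → All (λ y → ¬ (x ~ y)) ys → Any (a ~_) ys → x ~ a → ⊥
  absurd (y ∷ ys) (e ∷ es) (here r)  q = e (tr q r)
  absurd (y ∷ ys) (e ∷ es) (there r) q = absurd ys es r q

∑-cong-All : {xs : List A} {f g : A → ℚ} → All (λ x → f x ≡ g x) xs → ∑ xs f ≡ ∑ xs g
∑-cong-All []       = refl
∑-cong-All (e ∷ es) = cong₂ _+_ e (∑-cong-All es)

-- The sifting property of a delta function. The enumeration enters only through the value of its
-- indicator sum, which for lists of words comes from a product and not from distinctness.
∑-pick : {_~_ : A → A → Set} (_~?_ : Decidable₂ _~_) (xs : List A) (a : A) →
         ∑ xs (λ x → ⟦ x ~? a ⟧) ≡ 1ℚ → (f : A → ℚ) → (∀ {x} → x ~ a → f x ≡ f a) →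
         ∑ xs (λ x → ⟦ x ~? a ⟧ * f x) ≡ f a
∑-pick _~?_ xs a δ f f-cong = begin
  ∑ xs (λ x → ⟦ x ~? a ⟧ * f x) ≡⟨ ∑-cong xs (λ x → ⟦⟧-guard (x ~? a) f-cong) ⟩
  ∑ xs (λ x → ⟦ x ~? a ⟧ * f a) ≡⟨ ∑-*ʳ xs _ (f a) ⟩
  ∑ xs (λ x → ⟦ x ~? a ⟧) * f a ≡⟨ cong (λ s → s * f a) δ ⟩
  1ℚ * f a                      ≡⟨ ℚP.*-identityˡ (f a) ⟩
  f a                           ∎
  where open ≡-Reasoning

-- Integers inside the rationals, floors and ceilings

ι : ℕ → ℚ
ι n = + n ℚ./ 1

fromℤ : ℤ → ℚ
fromℤ z = z ℚ./ 1

toℚᵘ-/ : ∀ z n .{{_ : NonZero n}} → ℚ.toℚᵘ (z ℚ./ n) ℚᵘ.≃ (z ℚᵘ./ n)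
toℚᵘ-/ z (suc n) = ℚP.toℚᵘ-fromℚᵘ (ℚᵘ.mkℚᵘ z n)

fromℤ-+ : ∀ a b → fromℤ (a ℤ.+ b) ≡ fromℤ a + fromℤ b
fromℤ-+ a b = ℚP.toℚᵘ-injective (begin
  ℚ.toℚᵘ (fromℤ (a ℤ.+ b))                  ≈⟨ toℚᵘ-/ (a ℤ.+ b) 1 ⟩
  (a ℤ.+ b) ℚᵘ./ 1                          ≈⟨ ℚᵘ.*≡* (identity a b) ⟩
  (a ℚᵘ./ 1) ℚᵘ.+ (b ℚᵘ./ 1)                ≈⟨ ℚᵘP.+-cong (toℚᵘ-/ a 1) (toℚᵘ-/ b 1) ⟨
  ℚ.toℚᵘ (fromℤ a) ℚᵘ.+ ℚ.toℚᵘ (fromℤ b)    ≈⟨ ℚP.toℚᵘ-homo-+ (fromℤ a) (fromℤ b) ⟨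
  ℚ.toℚᵘ (fromℤ a + fromℤ b)                ∎)
  where
  open ℚᵘP.≃-Reasoning
  identity : ∀ a b → (a ℤ.+ b) ℤ.* (+ 1) ≡ (a ℤ.* (+ 1) ℤ.+ b ℤ.* (+ 1)) ℤ.* (+ 1)
  identity = solve-∀

fromℤ-neg : ∀ z → - fromℤ z ≡ fromℤ (ℤ.- z)
fromℤ-neg z = sym (inverseʳ-unique (fromℤ z) (fromℤ (ℤ.- z))
  (trans (sym (fromℤ-+ z (ℤ.- z))) (cong fromℤ (ℤP.+-inverseʳ z))))
  where open import Algebra.Properties.Group ℚP.+-0-group using (inverseʳ-unique)

fraction-* : ∀ a n .{{_ : NonZero n}} → (a ℚ./ n) * fromℤ (+ n) ≡ fromℤ a
fraction-* a n@(suc n-1) = ℚP.toℚᵘ-injective (begin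
  ℚ.toℚᵘ ((a ℚ./ n) * fromℤ (+ n))              ≈⟨ ℚP.toℚᵘ-homo-* (a ℚ./ n) (fromℤ (+ n)) ⟩
  ℚ.toℚᵘ (a ℚ./ n) ℚᵘ.* ℚ.toℚᵘ (fromℤ (+ n))    ≈⟨ ℚᵘP.*-cong (toℚᵘ-/ a n) (toℚᵘ-/ (+ n) 1) ⟩
  (a ℚᵘ./ n) ℚᵘ.* (+ n ℚᵘ./ 1)                  ≈⟨ ℚᵘ.*≡* (trans (ℤP.*-identityʳ _) (cong (λ k → a ℤ.* + k) (sym (ℕP.*-identityʳ n)))) ⟩
  a ℚᵘ./ 1                                      ≈⟨ toℚᵘ-/ a 1 ⟨
  ℚ.toℚᵘ (fromℤ a)                              ∎)
  where open ℚᵘP.≃-Reasoning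

fromℤ-* : ∀ a b → fromℤ (a ℤ.* b) ≡ fromℤ a * fromℤ b
fromℤ-* a b = ℚP.toℚᵘ-injective (begin
  ℚ.toℚᵘ (fromℤ (a ℤ.* b))                  ≈⟨ toℚᵘ-/ (a ℤ.* b) 1 ⟩
  (a ℤ.* b) ℚᵘ./ 1                          ≈⟨ ℚᵘ.*≡* refl ⟩
  (a ℚᵘ./ 1) ℚᵘ.* (b ℚᵘ./ 1)                ≈⟨ ℚᵘP.*-cong (toℚᵘ-/ a 1) (toℚᵘ-/ b 1) ⟨
  ℚ.toℚᵘ (fromℤ a) ℚᵘ.* ℚ.toℚᵘ (fromℤ b)    ≈⟨ ℚP.toℚᵘ-homo-* (fromℤ a) (fromℤ b) ⟨
  ℚ.toℚᵘ (fromℤ a * fromℤ b)                ∎)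
  where open ℚᵘP.≃-Reasoning

fromℤ-mono-≤ : ∀ {a b} → a ℤ.≤ b → fromℤ a ≤ fromℤ b
fromℤ-mono-≤ {a} {b} a≤b = ℚP.toℚᵘ-cancel-≤
  (ℚᵘP.≤-respʳ-≃ (ℚᵘP.≃-sym (toℚᵘ-/ b 1)) (ℚᵘP.≤-respˡ-≃ (ℚᵘP.≃-sym (toℚᵘ-/ a 1))
    (ℚᵘ.*≤* (ℤP.*-monoʳ-≤-nonNeg (+ 1) a≤b))))

fromℤ-mono-< : ∀ {a b} → a ℤ.< b → fromℤ a < fromℤ b
fromℤ-mono-< {a} {b} a<b = ℚP.toℚᵘ-cancel-<
  (ℚᵘP.<-respʳ-≃ (ℚᵘP.≃-sym (toℚᵘ-/ b 1)) (ℚᵘP.<-respˡ-≃ (ℚᵘP.≃-sym (toℚᵘ-/ a 1))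
    (ℚᵘ.*<* (ℤP.*-monoʳ-<-pos (+ 1) a<b))))

fromℤ-cancel-≤ : ∀ {a b} → fromℤ a ≤ fromℤ b → a ℤ.≤ b
fromℤ-cancel-≤ {a} {b} p with a ℤ.≤? b
... | yes a≤b = a≤b
... | no  a≰b = contradiction (ℚP.<-≤-trans (fromℤ-mono-< (ℤP.≰⇒> a≰b)) p) (ℚP.<-irrefl refl)

fromℤ-injective : ∀ {a b} → fromℤ a ≡ fromℤ b → a ≡ b
fromℤ-injective e = ℤP.≤-antisym (fromℤ-cancel-≤ (ℚP.≤-reflexive e)) (fromℤ-cancel-≤ (ℚP.≤-reflexive (sym e)))

-- Clearing the denominator gives `z * ↧ p ≤ ↥ p`, and division with remainder puts `↥ p` strictly
-- below `suc ⌊ p ⌋ * ↧ p`; cancelling `↧ p` leaves `z < suc ⌊ p ⌋`.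
≤-⌊⌋ : ∀ z p → fromℤ z ≤ p → z ℤ.≤ ℚ.⌊ p ⌋
≤-⌊⌋ z p@record{} z≤p =
  subst (z ℤ.≤_) (ℤP.pred-suc ℚ.⌊ p ⌋) (ℤP.i<j⇒i≤pred[j] {j = ℤ.suc ℚ.⌊ p ⌋} (ℤP.*-cancelʳ-<-nonNeg {z} {ℤ.suc ℚ.⌊ p ⌋} (ℚ.↧ p) (begin-strict
  z ℤ.* ℚ.↧ p                          ≡⟨⟩
  ℚᵘ.↥ (z ℚᵘ./ 1) ℤ.* ℚ.↧ p            ≤⟨ ℚᵘP.drop-*≤* (ℚᵘP.≤-respˡ-≃ (toℚᵘ-/ z 1) (ℚP.toℚᵘ-mono-≤ z≤p)) ⟩
  ℚ.↥ p ℤ.* (+ 1)                      ≡⟨ ℤP.*-identityʳ (ℚ.↥ p) ⟩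
  ℚ.↥ p                                <⟨ ℤD.n<s[n/ℕd]*d (ℚ.↥ p) (ℚ.↧ₙ p) ⟩
  ℤ.suc (ℚ.↥ p ℤD./ℕ ℚ.↧ₙ p) ℤ.* ℚ.↧ p ≡⟨ cong (λ k → ℤ.suc k ℤ.* ℚ.↧ p) (ℤD.div-pos-is-/ℕ (ℚ.↥ p) (ℚ.↧ₙ p)) ⟨
  ℤ.suc ℚ.⌊ p ⌋ ℤ.* ℚ.↧ p              ∎)))
  where open ℤP.≤-Reasoning

⌈⌉-≤ : ∀ q z → q ≤ fromℤ z → ℚ.⌈ q ⌉ ℤ.≤ z
⌈⌉-≤ q@record{} z q≤z = subst (ℚ.⌈ q ⌉ ℤ.≤_) (ℤP.neg-involutive z)
  (ℤP.neg-mono-≤ (≤-⌊⌋ (ℤ.- z) (- q) (subst (_≤ - q) (fromℤ-neg z) (ℚP.neg-antimono-≤ q≤z))))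

ι-+ : ∀ m n → ι (m ℕ.+ n) ≡ ι m + ι n
ι-+ m n = fromℤ-+ (+ m) (+ n)

ι-* : ∀ m n → ι (m ℕ.* n) ≡ ι m * ι n
ι-* m n = trans (cong fromℤ (ℤP.pos-* m n)) (fromℤ-* (+ m) (+ n))

ι-mono-≤ : ∀ {m n} → m ℕ.≤ n → ι m ≤ ι n
ι-mono-≤ m≤n = fromℤ-mono-≤ (ℤ.+≤+ m≤n)

ι-cancel-≤ : ∀ {m n} → ι m ≤ ι n → m ℕ.≤ n
ι-cancel-≤ p = ℤP.drop‿+≤+ (fromℤ-cancel-≤ p)

ι-injective : ∀ {m n} → ι m ≡ ι n → m ≡ n
ι-injective e = ℤP.+-injective (fromℤ-injective e)

∑-const : (xs : List A) (c : ℚ) → ∑ xs (λ _ → c) ≡ ι (length xs) * c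
∑-const []       c = sym (ℚP.*-zeroˡ c)
∑-const (x ∷ xs) c = begin
  c + ∑ xs (λ _ → c)           ≡⟨ cong (λ s → c + s) (∑-const xs c) ⟩
  c + ι (length xs) * c        ≡⟨ solve 2 (λ c l → c :+ l :* c := (con 1ℚ :+ l) :* c) refl c (ι (length xs)) ⟩
  (1ℚ + ι (length xs)) * c     ≡⟨ cong (λ s → s * c) (ι-+ 1 (length xs)) ⟨
  ι (suc (length xs)) * c      ∎
  where open ≡-Reasoning

ι-length-filter : {P : Pred A 0ℓ} (P? : Decidable P) (xs : List A) →
                  ι (length (filter P? xs)) ≡ ∑ xs (λ x → ⟦ P? x ⟧)
ι-length-filter P? [] = refl
ι-length-filter P? (x ∷ xs) with P? x
... | yes _ = trans (ι-+ 1 (length (filter P? xs))) (cong (λ s → 1ℚ + s) (ι-length-filter P? xs))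
... | no _  = trans (ι-length-filter P? xs) (sym (ℚP.+-identityˡ _))

-- Counting in finite abelian groups: translation, fibres, Lagrange

record FiniteAbelianGroup : Set₁ where
  field
    abelianGroup : AbelianGroup 0ℓ 0ℓ
  open AbelianGroup abelianGroup public
  field
    _≟_   : Decidable₂ _≈_
    elems : List Carrier
    -- Completeness and distinctness of the enumeration in one equation, a form that is
    -- multiplicative and hence passes easily from the ring to words.
    ∑-δ   : ∀ a → ∑ elems (λ x → ⟦ x ≟ a ⟧) ≡ 1ℚ

module FiniteGroupSums (G : FiniteAbelianGroup) where
  open FiniteAbelianGroup G renaming (refl to ≈-refl; sym to ≈-sym; trans to ≈-trans)
  open import Algebra.Properties.Group group using
    (//-rightDividesʳ; //-rightDividesˡ; ⁻¹-anti-homo-//; ⁻¹-anti-homo-∙; ε⁻¹≈ε)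

  count : {P : Pred Carrier 0ℓ} → Decidable P → ℕ
  count P? = length (filter P? elems)

  ι-count : {P : Pred Carrier 0ℓ} (P? : Decidable P) → ι (count P?) ≡ ∑ elems (λ x → ⟦ P? x ⟧)
  ι-count P? = ι-length-filter P? elems

  ∑-δ-* : (f : Carrier → ℚ) → (∀ {x y} → x ≈ y → f x ≡ f y) → ∀ a →
          ∑ elems (λ x → ⟦ x ≟ a ⟧ * f x) ≡ f a
  ∑-δ-* f f-cong a = ∑-pick _≟_ elems a (∑-δ a) f f-cong

  -- Expanding `f (x ∙ a)` by delta functions and swapping the sums leaves, for each y, the number
  -- of x with `y ≈ x ∙ a`; this is 1, since `y ∙ a ⁻¹` is the only such x.
  ∑-translate : (f : Carrier → ℚ) → (∀ {x y} → x ≈ y → f x ≡ f y) → ∀ a →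
                ∑ elems (λ x → f (x ∙ a)) ≡ ∑ elems f
  ∑-translate f f-cong a = begin
    ∑ elems (λ x → f (x ∙ a))
      ≡⟨ ∑-cong elems (λ x → ∑-δ-* f f-cong (x ∙ a)) ⟨
    ∑ elems (λ x → ∑ elems (λ y → ⟦ y ≟ (x ∙ a) ⟧ * f y))
      ≡⟨ ∑-swap elems elems _ ⟩
    ∑ elems (λ y → ∑ elems (λ x → ⟦ y ≟ (x ∙ a) ⟧ * f y))
      ≡⟨ ∑-cong elems (λ y → ∑-*ʳ elems _ (f y)) ⟩
    ∑ elems (λ y → ∑ elems (λ x → ⟦ y ≟ (x ∙ a) ⟧) * f y)
      ≡⟨ ∑-cong elems (λ y → cong (λ s → s * f y) (trans (∑-cong elems (moved y)) (∑-δ (y ∙ a ⁻¹)))) ⟩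
    ∑ elems (λ y → 1ℚ * f y)
      ≡⟨ ∑-cong elems (λ y → ℚP.*-identityˡ (f y)) ⟩
    ∑ elems f ∎
    where
    open ≡-Reasoning
    moved : ∀ y x → ⟦ y ≟ (x ∙ a) ⟧ ≡ ⟦ x ≟ (y ∙ a ⁻¹) ⟧
    moved y x = ⟦⟧-cong (y ≟ (x ∙ a)) (x ≟ (y ∙ a ⁻¹))
      (λ p → ≈-sym (≈-trans (∙-congʳ p) (//-rightDividesʳ a x)))
      (λ p → ≈-sym (≈-trans (∙-congʳ p) (//-rightDividesˡ a y)))

  complete : ∀ a → Any (_≈ a) elems
  complete a with any? (_≟ a) elems
  ... | yes p = p
  ... | no ¬p = contradiction (trans (sym (∑-δ a)) (none elems ¬p)) ℚP.1≢0
    where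
    none : ∀ xs → ¬ Any (_≈ a) xs → ∑ xs (λ x → ⟦ x ≟ a ⟧) ≡ 0ℚ
    none []       _  = refl
    none (x ∷ xs) ¬p = cong₂ _+_ (⟦⟧-no (x ≟ a) (¬p ∘ here)) (none xs (¬p ∘ there))

  ∃? : {P : Pred Carrier 0ℓ} → Decidable P → P Respects _≈_ → Dec (∃ P)
  ∃? P? P-resp = map′ Any.satisfied (λ (a , Pa) → Any.map (λ x≈a → P-resp (≈-sym x≈a) Pa) (complete a))
    (any? P? elems)

  module _ {D : Pred Carrier 0ℓ} (D? : Decidable D) (D-resp : D Respects _≈_)
           (f : Carrier → ℕ) (f-cong : ∀ {x y} → x ≈ y → f x ≡ f y) where

    minimum : ∃ D → ∃ λ m → D m × (∀ y → D y → f m ℕ.≤ f y)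
    minimum (x , Dx) = descend x Dx (<-wellFounded (f x))
      where
      descend : ∀ x → D x → Acc ℕ._<_ (f x) → ∃ λ m → D m × (∀ y → D y → f m ℕ.≤ f y)
      descend x Dx (acc rs) with ∃? (λ y → D? y ×-dec (f y ℕP.<? f x))
                                    (λ e (Dy , lt) → D-resp e Dy , subst (ℕ._< f x) (f-cong e) lt)
      ... | yes (y , Dy , lt) = descend y Dy (rs lt)
      ... | no ¬smaller       = x , Dx , λ y Dy → ℕP.≮⇒≥ (λ lt → ¬smaller (y , Dy , lt))

  module _ {P Q : Pred Carrier 0ℓ} (P? : Decidable P) (Q? : Decidable Q) (P⊆Q : P ⊆ Q) where

    count-mono-≤ : count P? ℕ.≤ count Q?
    count-mono-≤ = ι-cancel-≤ (subst₂ _≤_ (sym (ι-count P?)) (sym (ι-count Q?)) (∑-mono elems pointwise))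
      where
      pointwise : ∀ x → ⟦ P? x ⟧ ≤ ⟦ Q? x ⟧
      pointwise x with P? x | Q? x
      ... | yes _  | yes _  = ℚP.≤-refl
      ... | yes Px | no ¬Qx = contradiction (P⊆Q Px) ¬Qx
      ... | no _   | yes _  = ι-mono-≤ {0} {1} ℕ.z≤n
      ... | no _   | no _   = ℚP.≤-refl

    -- The indicators of `a` and of P have disjoint supports inside Q, and the former sums to 1.
    count-mono-< : P Respects _≈_ → Q Respects _≈_ → ∀ a → Q a → ¬ P a → count P? ℕ.< count Q?
    count-mono-< P-resp Q-resp a Qa ¬Pa = ι-cancel-≤ (begin
      ι (suc (count P?))                          ≡⟨ ι-+ 1 (count P?) ⟩
      1ℚ + ι (count P?)                           ≡⟨ cong₂ _+_ (sym (∑-δ a)) (ι-count P?) ⟩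
      ∑ elems (λ x → ⟦ x ≟ a ⟧) + ∑ elems (λ x → ⟦ P? x ⟧) ≡⟨ ∑-+ elems _ _ ⟨
      ∑ elems (λ x → ⟦ x ≟ a ⟧ + ⟦ P? x ⟧)        ≤⟨ ∑-mono elems pointwise ⟩
      ∑ elems (λ x → ⟦ Q? x ⟧)                    ≡⟨ ι-count Q? ⟨
      ι (count Q?)                                ∎)
      where
      open ℚP.≤-Reasoning
      pointwise : ∀ x → ⟦ x ≟ a ⟧ + ⟦ P? x ⟧ ≤ ⟦ Q? x ⟧
      pointwise x with x ≟ a | P? x | Q? x
      ... | yes e | yes Px | _      = contradiction (P-resp e Px) ¬Pa
      ... | yes _ | no _   | yes _  = ℚP.≤-refl
      ... | yes e | no _   | no ¬Qx = contradiction (Q-resp (≈-sym e) Qa) ¬Qx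
      ... | no _  | yes _  | yes _  = ℚP.≤-refl
      ... | no _  | yes Px | no ¬Qx = contradiction (P⊆Q Px) ¬Qx
      ... | no _  | no _   | yes _  = ι-mono-≤ {0} {1} ℕ.z≤n
      ... | no _  | no _   | no _   = ℚP.≤-refl

  record IsSubgroup (H : Pred Carrier 0ℓ) : Set where
    field
      resp   : H Respects _≈_
      ε-mem  : H ε
      ∙-mem  : ∀ {x y} → H x → H y → H (x ∙ y)
      ⁻¹-mem : ∀ {x} → H x → H (x ⁻¹)

  -- The target carries no group structure: of a homomorphism only the fact that translation
  -- preserves fibres is kept. This admits residues in ℕ, where addition is not respected on the
  -- nose, as well as cosets and coordinates of words.
  module Fibres
    {H : Pred Carrier 0ℓ} (H? : Decidable H) (H-sub : IsSubgroup H)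
    (S : DecSetoid 0ℓ 0ℓ) (ts : List (DecSetoid.Carrier S)) (φ : Carrier → DecSetoid.Carrier S)
    (φ-cong : ∀ {x y} → x ≈ y → DecSetoid._≈_ S (φ x) (φ y))
    (φ-translate : ∀ x y z → DecSetoid._≈_ S (φ x) (φ y) → DecSetoid._≈_ S (φ (x ∙ z)) (φ (y ∙ z)))
    (ts-δ : ∀ v → ∑ ts (λ t → ⟦ DecSetoid._≟_ S t (φ v) ⟧) ≡ 1ℚ)
    where
    open DecSetoid S using ()
      renaming (Carrier to T; _≈_ to _~_; _≟_ to _~?_; sym to ~-sym; trans to ~-trans)
    open IsSubgroup H-sub

    Ker : Pred Carrier 0ℓ
    Ker v = H v × φ v ~ φ ε

    Im : Pred T 0ℓ
    Im t = ∃ λ v → H v × t ~ φ v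

    Ker? : Decidable Ker
    Ker? v = H? v ×-dec (φ v ~? φ ε)

    Im? : Decidable Im
    Im? t = ∃? (λ v → H? v ×-dec (t ~? φ v)) (λ e (h , p) → resp e h , ~-trans p (φ-cong e))

    -- A nonempty fibre is a coset of the kernel: translating by a preimage u of t carries it onto
    -- `Ker`.
    fibre-sum : ∀ t (im? : Dec (Im t)) →
      ∑ elems (λ v → ⟦ H? v ⟧ * ⟦ t ~? φ v ⟧) ≡ ⟦ im? ⟧ * ∑ elems (λ v → ⟦ Ker? v ⟧)
    fibre-sum t (no ¬im) = trans (∑-zero elems empty) (sym (ℚP.*-zeroˡ (∑ elems (λ v → ⟦ Ker? v ⟧))))
      where
      empty : ∀ v → ⟦ H? v ⟧ * ⟦ t ~? φ v ⟧ ≡ 0ℚ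
      empty v with H? v | t ~? φ v
      ... | yes h | yes p = contradiction (v , h , p) ¬im
      ... | yes _ | no _  = refl
      ... | no _  | yes _ = refl
      ... | no _  | no _  = refl
    fibre-sum t (yes (u , Hu , t~φu)) = begin
      ∑ elems (λ v → ⟦ H? v ⟧ * ⟦ t ~? φ v ⟧)   ≡⟨ ∑-cong elems (λ v → ⟦⟧-×-dec (H? v) (t ~? φ v)) ⟨
      ∑ elems F                                 ≡⟨ ∑-translate F F-cong u ⟨
      ∑ elems (λ v → F (v ∙ u))                 ≡⟨ ∑-cong elems shift ⟩
      ∑ elems (λ v → ⟦ Ker? v ⟧)                ≡⟨ ℚP.*-identityˡ _ ⟨
      1ℚ * ∑ elems (λ v → ⟦ Ker? v ⟧)           ∎
      where
      open ≡-Reasoning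
      F? : Decidable (λ v → H v × t ~ φ v)
      F? v = H? v ×-dec (t ~? φ v)
      F : Carrier → ℚ
      F v = ⟦ F? v ⟧
      F-cong : ∀ {x y} → x ≈ y → F x ≡ F y
      F-cong {x} {y} e = ⟦⟧-cong (F? x) (F? y)
        (λ (h , p) → resp e h , ~-trans p (φ-cong e))
        (λ (h , p) → resp (≈-sym e) h , ~-trans p (φ-cong (≈-sym e)))
      shift : ∀ v → F (v ∙ u) ≡ ⟦ Ker? v ⟧
      shift v = ⟦⟧-cong (F? (v ∙ u)) (Ker? v)
        (λ (h , p) → resp (//-rightDividesʳ u v) (∙-mem h (⁻¹-mem Hu)) ,
          ~-trans (φ-cong (≈-sym (//-rightDividesʳ u v)))
            (~-trans (φ-translate _ _ (u ⁻¹) (~-trans (~-sym p) t~φu)) (φ-cong (inverseʳ u))))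
        (λ (h , p) → ∙-mem h Hu ,
          ~-trans t~φu (~-trans (φ-cong (≈-sym (identityˡ u))) (φ-translate _ _ u (~-sym p))))

    ∑-fibres : (f : T → ℚ) → (∀ {s t} → s ~ t → f s ≡ f t) →
      ∑ elems (λ v → ⟦ H? v ⟧ * f (φ v)) ≡ ι (count Ker?) * ∑ ts (λ t → ⟦ Im? t ⟧ * f t)
    ∑-fibres f f-cong = begin
      ∑ elems (λ v → ⟦ H? v ⟧ * f (φ v))
        ≡⟨ ∑-cong elems expand ⟩
      ∑ elems (λ v → ∑ ts (λ t → ⟦ H? v ⟧ * ⟦ t ~? φ v ⟧ * f t))
        ≡⟨ ∑-swap elems ts _ ⟩
      ∑ ts (λ t → ∑ elems (λ v → ⟦ H? v ⟧ * ⟦ t ~? φ v ⟧ * f t))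
        ≡⟨ ∑-cong ts (λ t → trans (∑-*ʳ elems _ (f t)) (cong (λ s → s * f t) (fibre-sum t (Im? t)))) ⟩
      ∑ ts (λ t → ⟦ Im? t ⟧ * K * f t)
        ≡⟨ ∑-cong ts (λ t → solve 3 (λ a b c → a :* b :* c := b :* (a :* c)) refl ⟦ Im? t ⟧ K (f t)) ⟩
      ∑ ts (λ t → K * (⟦ Im? t ⟧ * f t))
        ≡⟨ ∑-*ˡ ts K _ ⟩
      K * ∑ ts (λ t → ⟦ Im? t ⟧ * f t)
        ≡⟨ cong (λ s → s * ∑ ts (λ t → ⟦ Im? t ⟧ * f t)) (ι-count Ker?) ⟨
      ι (count Ker?) * ∑ ts (λ t → ⟦ Im? t ⟧ * f t) ∎
      where
      open ≡-Reasoning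
      K = ∑ elems (λ v → ⟦ Ker? v ⟧)
      expand : ∀ v → ⟦ H? v ⟧ * f (φ v) ≡ ∑ ts (λ t → ⟦ H? v ⟧ * ⟦ t ~? φ v ⟧ * f t)
      expand v = begin
        ⟦ H? v ⟧ * f (φ v)
          ≡⟨ cong (λ s → ⟦ H? v ⟧ * s) (∑-pick _~?_ ts (φ v) (ts-δ v) f f-cong) ⟨
        ⟦ H? v ⟧ * ∑ ts (λ t → ⟦ t ~? φ v ⟧ * f t)
          ≡⟨ ∑-*ˡ ts ⟦ H? v ⟧ _ ⟨
        ∑ ts (λ t → ⟦ H? v ⟧ * (⟦ t ~? φ v ⟧ * f t))
          ≡⟨ ∑-cong ts (λ t → ℚP.*-assoc ⟦ H? v ⟧ ⟦ t ~? φ v ⟧ (f t)) ⟨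
        ∑ ts (λ t → ⟦ H? v ⟧ * ⟦ t ~? φ v ⟧ * f t)     ∎

    ι-count-fibres : ι (count H?) ≡ ι (count Ker?) * ι (length (filter Im? ts))
    ι-count-fibres = begin
      ι (count H?)                                  ≡⟨ ι-count H? ⟩
      ∑ elems (λ v → ⟦ H? v ⟧)                      ≡⟨ ∑-cong elems (λ v → ℚP.*-identityʳ ⟦ H? v ⟧) ⟨
      ∑ elems (λ v → ⟦ H? v ⟧ * 1ℚ)                 ≡⟨ ∑-fibres (λ _ → 1ℚ) (λ _ → refl) ⟩
      ι (count Ker?) * ∑ ts (λ t → ⟦ Im? t ⟧ * 1ℚ)
        ≡⟨ cong (λ s → ι (count Ker?) * s) (trans (∑-cong ts (λ t → ℚP.*-identityʳ ⟦ Im? t ⟧)) (sym (ι-length-filter Im? ts))) ⟩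
      ι (count Ker?) * ι (length (filter Im? ts))   ∎
      where open ≡-Reasoning

    count-fibres : count H? ≡ count Ker? ℕ.* length (filter Im? ts)
    count-fibres = ι-injective (trans ι-count-fibres (sym (ι-* (count Ker?) _)))

  module _ {K : Pred Carrier 0ℓ} (K? : Decidable K) (K-sub : IsSubgroup K) where
    private module K = IsSubgroup K-sub

    cosets : DecSetoid 0ℓ 0ℓ
    cosets = record
      { _≈_ = λ x y → K (x ∙ y ⁻¹)
      ; isDecEquivalence = record
        { isEquivalence = record
          { refl  = λ {x} → K.resp (≈-sym (inverseʳ x)) K.ε-mem
          ; sym   = λ {x} {y} p → K.resp (⁻¹-anti-homo-// x y) (K.⁻¹-mem p)
          ; trans = λ {x} {y} {z} p q → K.resp (x//y∙y//z x y z) (K.∙-mem p q)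
          }
        ; _≟_ = λ x y → K? (x ∙ y ⁻¹)
        }
      }
      where
      x//y∙y//z : ∀ x y z → (x ∙ y ⁻¹) ∙ (y ∙ z ⁻¹) ≈ x ∙ z ⁻¹
      x//y∙y//z x y z = ≈-trans (≈-sym (assoc _ y (z ⁻¹))) (∙-congʳ (//-rightDividesˡ y x))

    private module S = DecSetoid cosets

    ≈⇒coset : ∀ {x y} → x ≈ y → x S.≈ y
    ≈⇒coset {x} {y} e = K.resp (≈-trans (≈-sym (inverseʳ x)) (∙-congˡ (⁻¹-cong e))) K.ε-mem

    -- The quotient by K is the same carrier with a coarser equality, so the projection is `id` and
    -- its kernel in H is K. The index t counts the chosen representatives whose coset meets H.
    lagrange : {H : Pred Carrier 0ℓ} (H? : Decidable H) → IsSubgroup H → K ⊆ H →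
               ∃ λ t → count H? ≡ count K? ℕ.* t
    lagrange {H} H? H-sub K⊆H = length (filter Im? representatives) ,
      trans count-fibres (cong (λ k → k ℕ.* length (filter Im? representatives)) |Ker|≡|K|)
      where
      representatives = List.deduplicate S._≟_ elems
      x∙z//y∙z : ∀ x y z → (x ∙ z) ∙ (y ∙ z) ⁻¹ ≈ x ∙ y ⁻¹
      x∙z//y∙z x y z = ≈-trans (∙-congˡ (⁻¹-anti-homo-∙ y z))
        (≈-trans (≈-sym (assoc _ (z ⁻¹) (y ⁻¹))) (∙-congʳ (//-rightDividesʳ z x)))
      coset-translate : ∀ x y z → x S.≈ y → (x ∙ z) S.≈ (y ∙ z)
      coset-translate x y z = K.resp (≈-sym (x∙z//y∙z x y z))
      representatives-δ : ∀ v → ∑ representatives (λ t → ⟦ t S.≟ v ⟧) ≡ 1ℚ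
      representatives-δ v = ∑-indicator S._≟_ S.sym S.trans representatives v
        (deduplicate-! cosets elems)
        (∈-deduplicate⁺ S.setoid S._≟_ (λ p q → S.trans q (S.sym p))
          (Any.map (λ e → ≈⇒coset (≈-sym e)) (complete v)))
      open Fibres H? H-sub cosets representatives id ≈⇒coset coset-translate representatives-δ
      |Ker|≡|K| : count Ker? ≡ count K?
      |Ker|≡|K| = ℕP.≤-antisym
        (count-mono-≤ Ker? K? (λ {v} (_ , p) → K.resp (v//ε v) p))
        (count-mono-≤ K? Ker? (λ {v} p → K⊆H p , K.resp (≈-sym (v//ε v)) p))
        where
        v//ε : ∀ v → v ∙ ε ⁻¹ ≈ v
        v//ε v = ≈-trans (∙-congˡ ε⁻¹≈ε) (identityʳ v)

-- A rational function on residues with vanishing sums over multiples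

∑-upTo-δ : ∀ m {a} → a ℕ.< m → ∑ (upTo m) (λ b → ⟦ b ℕP.≟ a ⟧) ≡ 1ℚ
∑-upTo-δ m {a} a<m = ∑-indicator ℕP._≟_ sym trans (upTo m) a (upTo⁺ m) (∈-upTo⁺ a<m)

∑-multiples : (m g : ℕ) → (ℕ → ℚ) → ℚ
∑-multiples m g ψ = ∑ (upTo m) (λ b → ⟦ g ∣? b ⟧ * ψ b)

module _ (m : ℕ) where

  ∑-multiples-update : ∀ {b} → b ℕ.< m → ∀ g (ψ : ℕ → ℚ) c →
    ∑-multiples m g (λ x → ψ x + c * ⟦ x ℕP.≟ b ⟧) ≡ ∑-multiples m g ψ + c * ⟦ g ∣? b ⟧
  ∑-multiples-update {b} b<m g ψ c = begin
    ∑ (upTo m) (λ x → ⟦ g ∣? x ⟧ * (ψ x + c * ⟦ x ℕP.≟ b ⟧))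
      ≡⟨ ∑-cong (upTo m) (λ x → solve 4 (λ d p c e → d :* (p :+ c :* e) := d :* p :+ c :* (e :* d)) refl
           ⟦ g ∣? x ⟧ (ψ x) c ⟦ x ℕP.≟ b ⟧) ⟩
    ∑ (upTo m) (λ x → ⟦ g ∣? x ⟧ * ψ x + c * (⟦ x ℕP.≟ b ⟧ * ⟦ g ∣? x ⟧))
      ≡⟨ ∑-+ (upTo m) _ _ ⟩
    ∑-multiples m g ψ + ∑ (upTo m) (λ x → c * (⟦ x ℕP.≟ b ⟧ * ⟦ g ∣? x ⟧))
      ≡⟨ cong (λ s → ∑-multiples m g ψ + s) (trans (∑-*ˡ (upTo m) c _)
           (cong (λ s → c * s) (∑-pick ℕP._≟_ (upTo m) b (∑-upTo-δ m b<m) (λ x → ⟦ g ∣? x ⟧) (cong (λ x → ⟦ g ∣? x ⟧))))) ⟩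
    ∑-multiples m g ψ + c * ⟦ g ∣? b ⟧ ∎
    where open ≡-Reasoning

  -- Subtracting a multiple of the indicator of b = m − (j + 1) corrects the sum over the multiples of b
  -- without disturbing those of any g > b, as g ∤ b.
  multiplesWeightFrom : ∀ j → ∃ λ (ψ : ℕ → ℚ) → ψ 0 ≡ 1ℚ ×
    (∀ g → 0 ℕ.< g → g ℕ.< m → m ℕ.≤ g ℕ.+ j → ∑-multiples m g ψ ≡ 0ℚ)
  multiplesWeightFrom zero = (λ b → ⟦ b ℕP.≟ 0 ⟧) , refl ,
    λ g _ g<m m≤g → contradiction (ℕP.<-≤-trans g<m (subst (m ℕ.≤_) (ℕP.+-identityʳ g) m≤g)) (ℕP.n≮n g)
  multiplesWeightFrom (suc j) with multiplesWeightFrom j | m ℕP.≤? suc j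
  -- Here `b` would be 0, where the value 1 must stay untouched; every positive g is already
  -- covered.
  ... | ψ , ψ0 , good | yes m≤1+j =
    ψ , ψ0 , λ g 0<g g<m _ → good g 0<g g<m (ℕP.≤-trans m≤1+j (ℕP.+-monoˡ-≤ j 0<g))
  ... | ψ , ψ0 , good | no m≰1+j = ψ′ , ψ′0 , good′
    where
    b = m ∸ suc j
    b+1+j≡m : b ℕ.+ suc j ≡ m
    b+1+j≡m = ℕP.m∸n+n≡m (ℕP.<⇒≤ (ℕP.≰⇒> m≰1+j))
    0<b : 0 ℕ.< b
    0<b = ℕP.m<n⇒0<n∸m (ℕP.≰⇒> m≰1+j)
    b<m : b ℕ.< m
    b<m = subst (b ℕ.<_) b+1+j≡m (ℕP.m<m+n b ℕ.z<s)
    c = - ∑-multiples m b ψ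
    ψ′ : ℕ → ℚ
    ψ′ x = ψ x + c * ⟦ x ℕP.≟ b ⟧
    ψ′0 : ψ′ 0 ≡ 1ℚ
    ψ′0 = cong₂ _+_ ψ0 (trans (cong (λ s → c * s) (⟦⟧-no (0 ℕP.≟ b) (ℕP.<⇒≢ 0<b))) (ℚP.*-zeroʳ c))
    good′ : ∀ g → 0 ℕ.< g → g ℕ.< m → m ℕ.≤ g ℕ.+ suc j → ∑-multiples m g ψ′ ≡ 0ℚ
    good′ g 0<g g<m m≤ with g ℕP.≟ b
    ... | yes refl = begin
      ∑-multiples m g ψ′                          ≡⟨ ∑-multiples-update b<m g ψ c ⟩
      ∑-multiples m g ψ + c * ⟦ g ∣? g ⟧
        ≡⟨ cong (λ s → ∑-multiples m g ψ + c * s) (⟦⟧-yes (g ∣? g) ℕD.∣-refl) ⟩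
      ∑-multiples m g ψ + c * 1ℚ                  ≡⟨ cong (λ s → ∑-multiples m g ψ + s) (ℚP.*-identityʳ c) ⟩
      ∑-multiples m g ψ + c                       ≡⟨ ℚP.+-inverseʳ (∑-multiples m g ψ) ⟩
      0ℚ                                          ∎
      where open ≡-Reasoning
    ... | no g≢b = begin
      ∑-multiples m g ψ′                          ≡⟨ ∑-multiples-update b<m g ψ c ⟩
      ∑-multiples m g ψ + c * ⟦ g ∣? b ⟧
        ≡⟨ cong₂ (λ s t → s + c * t) (good g 0<g g<m m≤g+j) (⟦⟧-no (g ∣? b) g∤b) ⟩
      0ℚ + c * 0ℚ                                 ≡⟨ trans (ℚP.+-identityˡ _) (ℚP.*-zeroʳ c) ⟩
      0ℚ                                          ∎
      where
      open ≡-Reasoning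
      b<g : b ℕ.< g
      b<g = ℕP.≤∧≢⇒< (ℕP.+-cancelʳ-≤ (suc j) b g (subst (ℕ._≤ g ℕ.+ suc j) (sym b+1+j≡m) m≤)) (g≢b ∘ sym)
      m≤g+j : m ℕ.≤ g ℕ.+ j
      m≤g+j = subst (ℕ._≤ g ℕ.+ j) (trans (sym (ℕP.+-suc b j)) b+1+j≡m) (ℕP.+-monoˡ-≤ j b<g)
      g∤b : ¬ (g ∣ b)
      g∤b g∣b = ℕP.<⇒≱ b<g (ℕD.∣⇒≤ {{ℕ.>-nonZero 0<b}} g∣b)

  abstract
    -- A rational stand-in for a primitive root of unity, whose powers cancel over each nonzero
    -- subgroup of ℤ/m. Asking for all g below m, and not just for divisors of m, makes the linear
    -- system triangular and avoids showing that the image of an ideal is generated by a divisor.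
    multiplesWeight : ∃ λ (ψ : ℕ → ℚ) → ψ 0 ≡ 1ℚ × (∀ g → 0 ℕ.< g → g ℕ.< m → ∑-multiples m g ψ ≡ 0ℚ)
    multiplesWeight with multiplesWeightFrom m
    ... | ψ , ψ0 , good = ψ , ψ0 , λ g 0<g g<m → good g 0<g g<m (ℕP.m≤n+m m g)

-- Congruences and additive characters

infix 4 _≡ₘ_[_]
-- Wrapped in a record so that both sides can be read off from the type; signed divisibility makes
-- the closure laws into ring identities.
record _≡ₘ_[_] (a b : ℤ) (m : ℕ) : Set where
  constructor mod
  field
    m∣a-b : (+ m) ℤS.∣ (a ℤ.- b)

open _≡ₘ_[_] public

module _ {m : ℕ} where

  mod-sym : ∀ {a b} → a ≡ₘ b [ m ] → b ≡ₘ a [ m ]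
  mod-sym {a} {b} (mod p) = mod (subst ((+ m) ℤS.∣_) (identity a b) (ℤS.∣m⇒∣-m p))
    where
    identity : ∀ a b → ℤ.- (a ℤ.- b) ≡ b ℤ.- a
    identity = solve-∀

  mod-trans : ∀ {a b c} → a ≡ₘ b [ m ] → b ≡ₘ c [ m ] → a ≡ₘ c [ m ]
  mod-trans {a} {b} {c} (mod p) (mod q) = mod (subst ((+ m) ℤS.∣_) (identity a b c) (ℤS.∣m∣n⇒∣m+n p q))
    where
    identity : ∀ a b c → (a ℤ.- b) ℤ.+ (b ℤ.- c) ≡ a ℤ.- c
    identity = solve-∀

  mod-+ : ∀ {a b c d} → a ≡ₘ b [ m ] → c ≡ₘ d [ m ] → a ℤ.+ c ≡ₘ b ℤ.+ d [ m ]
  mod-+ {a} {b} {c} {d} (mod p) (mod q) = mod (subst ((+ m) ℤS.∣_) (identity a b c d) (ℤS.∣m∣n⇒∣m+n p q))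
    where
    identity : ∀ a b c d → (a ℤ.- b) ℤ.+ (c ℤ.- d) ≡ (a ℤ.+ c) ℤ.- (b ℤ.+ d)
    identity = solve-∀

  mod-cancelʳ : ∀ {a b} c → a ℤ.+ c ≡ₘ b ℤ.+ c [ m ] → a ≡ₘ b [ m ]
  mod-cancelʳ {a} {b} c (mod p) = mod (subst ((+ m) ℤS.∣_) (identity a b c) p)
    where
    identity : ∀ a b c → (a ℤ.+ c) ℤ.- (b ℤ.+ c) ≡ a ℤ.- b
    identity = solve-∀

  mod-refl : ∀ a → a ≡ₘ a [ m ]
  mod-refl a = mod (ℤS.divides (+ 0) (ℤP.+-inverseʳ a))

  -- The distance of a and b is at most their maximum, hence below m, so m divides it only if it is
  -- 0.
  residue-unique : ∀ {a b} → a ℕ.< m → b ℕ.< m → (+ a) ≡ₘ (+ b) [ m ] → a ≡ b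
  residue-unique {a} {b} a<m b<m (mod p) with ℤ.∣ (+ a) ℤ.- (+ b) ∣ in eq
  ... | zero  = ℤP.+-injective (ℤP.i-j≡0⇒i≡j (+ a) (+ b) (ℤP.∣i∣≡0⇒i≡0 eq))
  ... | suc k = contradiction (ℕD.∣⇒≤ (subst (m ∣_) eq (ℤS.∣⇒∣ᵤ p)))
                  (ℕP.<⇒≱ (subst (ℕ._< m) eq (ℕP.≤-<-trans bound (ℕP.⊔-pres-<m a<m b<m))))
    where
    bound : ℤ.∣ (+ a) ℤ.- (+ b) ∣ ℕ.≤ a ℕ.⊔ b
    bound = subst (λ z → ℤ.∣ z ∣ ℕ.≤ a ℕ.⊔ b) (sym (ℤP.m-n≡m⊖n a b)) (ℤP.∣m⊝n∣≤m⊔n a b)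

  mod-%ℕ : .{{_ : NonZero m}} → ∀ a → a ≡ₘ (+ (a ℤD.%ℕ m)) [ m ]
  mod-%ℕ a = mod (ℤS.divides (a ℤD./ℕ m) (trans (cong (ℤ._- (+ (a ℤD.%ℕ m))) (ℤD.a≡a%ℕn+[a/ℕn]*n a m))
    (identity (+ (a ℤD.%ℕ m)) ((a ℤD./ℕ m) ℤ.* (+ m)))))
    where
    identity : ∀ r q → (r ℤ.+ q) ℤ.- r ≡ q
    identity = solve-∀

module RingTheory (R : FiniteRing) where
  private module R = FiniteRing R
  open R using (Carrier; _≈_; 0#; 1#)
  open import Algebra.Properties.Ring R.ring using (-1*x≈-x)

  additiveGroup : FiniteAbelianGroup
  additiveGroup = record
    { abelianGroup = R.+-abelianGroup
    ; _≟_          = R._≟_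
    ; elems        = R.elems
    ; ∑-δ          = λ a → ∑-indicator R._≟_ R.sym R.trans R.elems a R.distinct (R.complete a)
    }

  open FiniteGroupSums additiveGroup public

  leftIdeal⇒subgroup : ∀ {I} → IsLeftIdeal R I → IsSubgroup I
  leftIdeal⇒subgroup I-ideal = record
    { resp   = resp
    ; ε-mem  = has0
    ; ∙-mem  = +-cl
    ; ⁻¹-mem = λ {x} Ix → resp (-1*x≈-x x) (*-cl (R.- 1#) Ix)
    }
    where open IsLeftIdeal I-ideal

  module Character (χ : Carrier → ℤ) (χ-char : IsCharacter R χ) where
    private
      m = card R
      instance
        m≢0 : NonZero m
        m≢0 = card-nonZero R

    -- The character is meaningful only modulo `m`; least nonnegative residues give it an order, so
    -- that a least positive value can be chosen.
    ρ : Carrier → ℕ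
    ρ x = χ x ℤD.%ℕ m

    ρ<m : ∀ x → ρ x ℕ.< m
    ρ<m x = ℤD.n%ℕd<d (χ x) m

    χ≡ₘρ : ∀ x → χ x ≡ₘ (+ ρ x) [ m ]
    χ≡ₘρ x = mod-%ℕ (χ x)

    χ-+ : ∀ x y → χ (x R.+ y) ≡ₘ χ x ℤ.+ χ y [ m ]
    χ-+ x y = mod (ℤS.∣ᵤ⇒∣ (proj₂ χ-char x y))

    ρ-unique : ∀ {x a} → a ℕ.< m → χ x ≡ₘ (+ a) [ m ] → ρ x ≡ a
    ρ-unique {x} a<m p = residue-unique (ρ<m x) a<m (mod-trans (mod-sym (χ≡ₘρ x)) p)

    ρ-cong : ∀ {x y} → x ≈ y → ρ x ≡ ρ y
    ρ-cong {x} {y} x≈y = ρ-unique (ρ<m y) (mod-trans (mod (ℤS.∣ᵤ⇒∣ (proj₁ χ-char x y x≈y))) (χ≡ₘρ y))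

    ρ≡⇒χ≡ₘ : ∀ {x y} → ρ x ≡ ρ y → χ x ≡ₘ χ y [ m ]
    ρ≡⇒χ≡ₘ {x} {y} e = mod-trans (χ≡ₘρ x) (subst (λ r → (+ r) ≡ₘ χ y [ m ]) (sym e) (mod-sym (χ≡ₘρ y)))

    ρ-translate : ∀ x y z → ρ x ≡ ρ y → ρ (x R.+ z) ≡ ρ (y R.+ z)
    ρ-translate x y z e = ρ-unique (ρ<m (y R.+ z))
      (mod-trans (χ-+ x z) (mod-trans (mod-+ (ρ≡⇒χ≡ₘ e) (mod-refl (χ z)))
        (mod-trans (mod-sym (χ-+ y z)) (χ≡ₘρ (y R.+ z)))))

    -- Residues add exactly when no carry occurs. This and the subtraction without borrow below
    -- suffice to describe the image of an ideal.
    ρ-+ : ∀ x y → ρ x ℕ.+ ρ y ℕ.< m → ρ (x R.+ y) ≡ ρ x ℕ.+ ρ y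
    ρ-+ x y lt = ρ-unique lt (mod-trans (χ-+ x y) (mod-+ (χ≡ₘρ x) (χ≡ₘρ y)))

    ρ-- : ∀ x y → ρ y ℕ.≤ ρ x → ρ (x R.- y) ≡ ρ x ∸ ρ y
    ρ-- x y y≤x = ρ-unique (ℕP.≤-<-trans (ℕP.m∸n≤m (ρ x) (ρ y)) (ρ<m x)) (mod-cancelʳ (+ ρ y)
      (mod-trans (mod-+ (mod-refl (χ (x R.- y))) (mod-sym (χ≡ₘρ y)))
        (mod-trans (mod-sym (χ-+ (x R.- y) y))
          (mod-trans (ρ≡⇒χ≡ₘ (ρ-cong (//-rightDividesˡ y x)))
            (subst (λ r → χ x ≡ₘ (+ r) [ m ]) (sym (ℕP.m∸n+n≡m y≤x)) (χ≡ₘρ x))))))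
      where open import Algebra.Properties.Group (R.+-group) using (//-rightDividesˡ)

    ρ-0# : ρ 0# ≡ 0
    ρ-0# = trans (sym (ρ-cong (R.-‿inverseʳ 0#))) (trans (ρ-- 0# 0# ℕP.≤-refl) (ℕP.n∸n≡0 (ρ 0#)))

    ψ : ℕ → ℚ
    ψ = proj₁ (multiplesWeight m)

    ψ-0 : ψ 0 ≡ 1ℚ
    ψ-0 = proj₁ (proj₂ (multiplesWeight m))

    -- The image of I under ρ consists of the multiples of its least positive element, on which ψ sums
    -- to zero; the fibres of ρ on I all have the same size.
    module _ {I : Pred Carrier 0ℓ} (I? : Decidable I) (I-ideal : IsLeftIdeal R I)
             (χ-nontrivial : ¬ KerContains R χ I) where
      open IsLeftIdeal I-ideal
      open IsSubgroup (leftIdeal⇒subgroup I-ideal) using (⁻¹-mem)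
      open Fibres I? (leftIdeal⇒subgroup I-ideal) (decSetoid ℕP._≟_) (upTo m) ρ ρ-cong
        ρ-translate (λ v → ∑-upTo-δ m (ρ<m v))

      private
        Positive : Pred Carrier 0ℓ
        Positive x = I x × 0 ℕ.< ρ x

        Positive? : Decidable Positive
        Positive? x = I? x ×-dec (0 ℕP.<? ρ x)

        Positive-resp : Positive Respects _≈_
        Positive-resp e (Ix , p) = resp e Ix , subst (0 ℕ.<_) (ρ-cong e) p

        somePositive : ∃ Positive
        somePositive = case ∃? Positive? Positive-resp of λ where
          (yes p) → p
          -- If every residue on I were 0, the kernel of χ would contain I.
          (no ¬p) → contradiction (λ x Ix → ℤS.∣⇒∣ᵤ (m∣a-b (subst (λ r → χ x ≡ₘ (+ r) [ m ])
                        (ℕP.n≤0⇒n≡0 (ℕP.≮⇒≥ (λ lt → ¬p (x , Ix , lt)))) (χ≡ₘρ x)))) χ-nontrivial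

      module _ (x₀ : Carrier) (Ix₀ : I x₀) (0<g : 0 ℕ.< ρ x₀) (g-least : ∀ y → Positive y → ρ x₀ ℕ.≤ ρ y) where
        private
          g = ρ x₀

          -- Euclid by repeated subtraction: a nonzero residue is at least g, so `x - x₀` lies in I
          -- and has residue smaller by exactly g.
          g-divides : ∀ x → I x → Acc ℕ._<_ (ρ x) → g ∣ ρ x
          g-divides x Ix (acc rs) with ρ x ℕP.≟ 0
          ... | yes ρx≡0 = subst (g ∣_) (sym ρx≡0) (g ℕD.∣0)
          ... | no  ρx≢0 = subst (g ∣_) (ℕP.m∸n+n≡m g≤ρx)
            (ℕD.∣m∣n⇒∣m+n (subst (g ∣_) eq (g-divides (x R.- x₀) (+-cl Ix (⁻¹-mem Ix₀)) (rs smaller))) ℕD.∣-refl)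
            where
            g≤ρx : g ℕ.≤ ρ x
            g≤ρx = g-least x (Ix , ℕP.n≢0⇒n>0 ρx≢0)
            eq : ρ (x R.- x₀) ≡ ρ x ∸ g
            eq = ρ-- x x₀ g≤ρx
            smaller : ρ (x R.- x₀) ℕ.< ρ x
            smaller = subst (ℕ._< ρ x) (sym eq) (ℕP.∸-monoʳ-< 0<g g≤ρx)

          -- Adding `x₀` to itself q times reaches `q * g` without a carry, because all intermediate
          -- multiples stay below m.
          multiple-in-image : ∀ q → q ℕ.* g ℕ.< m → Im (q ℕ.* g)
          multiple-in-image zero    _  = 0# , has0 , sym ρ-0#
          multiple-in-image (suc q) lt with multiple-in-image q (ℕP.≤-<-trans (ℕP.m≤n+m (q ℕ.* g) g) lt)
          ... | v , Iv , e = x₀ R.+ v , +-cl Ix₀ Iv ,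
            trans (cong (g ℕ.+_) e) (sym (ρ-+ x₀ v (subst (ℕ._< m) (cong (g ℕ.+_) e) lt)))

          ⟦Im⟧ : ∀ {t} → t ℕ.< m → ⟦ Im? t ⟧ ≡ ⟦ g ∣? t ⟧
          ⟦Im⟧ {t} t<m = ⟦⟧-cong (Im? t) (g ∣? t)
            (λ { (v , Iv , refl) → g-divides v Iv (<-wellFounded (ρ v)) })
            (λ { (divides q refl) → multiple-in-image q t<m })

        ∑-ideal-ψ-least : ∑ R.elems (λ x → ⟦ I? x ⟧ * ψ (ρ x)) ≡ 0ℚ
        ∑-ideal-ψ-least = begin
          ∑ R.elems (λ x → ⟦ I? x ⟧ * ψ (ρ x))                 ≡⟨ ∑-fibres ψ (cong ψ) ⟩
          ι (count Ker?) * ∑ (upTo m) (λ t → ⟦ Im? t ⟧ * ψ t)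
            ≡⟨ cong (λ s → ι (count Ker?) * s) (∑-cong-All (All.tabulate λ t∈ → cong (λ s → s * ψ _) (⟦Im⟧ (∈-upTo⁻ t∈)))) ⟩
          ι (count Ker?) * ∑-multiples m g ψ
            ≡⟨ cong (λ s → ι (count Ker?) * s) (proj₂ (proj₂ (multiplesWeight m)) g 0<g (ρ<m x₀)) ⟩
          ι (count Ker?) * 0ℚ                                  ≡⟨ ℚP.*-zeroʳ (ι (count Ker?)) ⟩
          0ℚ                                                   ∎
          where open ≡-Reasoning

      ∑-ideal-ψ : ∑ R.elems (λ x → ⟦ I? x ⟧ * ψ (ρ x)) ≡ 0ℚ
      ∑-ideal-ψ = case minimum Positive? Positive-resp ρ ρ-cong somePositive of
        λ (x₀ , (Ix₀ , 0<g) , g-least) → ∑-ideal-ψ-least x₀ Ix₀ 0<g g-least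

-- Sums of a homogeneous weight over arbitrary left ideals

module HomogeneousWeight (R : FiniteRing) where
  private module R = FiniteRing R
  open R using (Carrier; _≈_; 0#; 1#)
  open RingTheory R

  InRx-resp : ∀ x → InRx R x Respects _≈_
  InRx-resp x y≈z (r , y≈rx) = r , R.trans (R.sym y≈z) y≈rx

  InRx-refl : ∀ x → InRx R x x
  InRx-refl x = 1# , R.sym (R.*-identityˡ x)

  InRx-* : ∀ {x y} r → InRx R x y → InRx R x (r R.* y)
  InRx-* {x} r (s , y≈sx) = r R.* s , R.trans (R.*-congˡ y≈sx) (R.sym (R.*-assoc r s x))

  InRx-trans : ∀ {x y z} → InRx R x y → InRx R y z → InRx R x z
  InRx-trans {x} xy (r , z≈ry) = InRx-resp x (R.sym z≈ry) (InRx-* r xy)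

  InRx-respˡ : ∀ {x y z} → x ≈ y → InRx R x z → InRx R y z
  InRx-respˡ {x} {y} x≈y = InRx-trans (InRx-resp y (R.sym x≈y) (InRx-refl y))

  InRx-isLeftIdeal : ∀ x → IsLeftIdeal R (InRx R x)
  InRx-isLeftIdeal x = record
    { resp = InRx-resp x
    ; has0 = 0# , R.sym (R.zeroˡ x)
    ; +-cl = λ (r , p) (s , q) → r R.+ s , R.trans (R.+-cong p q) (R.sym (R.distribʳ x r s))
    ; *-cl = λ r → InRx-* r
    }

  -- Size of the complement of Rx: minimising it, as `minimum` can, selects an inclusion-maximal
  -- principal left ideal.
  cocount : Carrier → ℕ
  cocount x = count (λ y → ¬? (InRx? R x y))

  cocount-cong : ∀ {x y} → x ≈ y → cocount x ≡ cocount y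
  cocount-cong e = ℕP.≤-antisym (mono e) (mono (R.sym e))
    where
    mono : ∀ {x y} → x ≈ y → cocount x ℕ.≤ cocount y
    mono {x} {y} x≈y = count-mono-≤ (λ z → ¬? (InRx? R x z)) (λ z → ¬? (InRx? R y z))
      (λ ¬p p → ¬p (InRx-respˡ (R.sym x≈y) p))

  cocount-least⇒maximal : ∀ {x y} → cocount x ℕ.≤ cocount y → InRx R y x → InRx R x y
  cocount-least⇒maximal {x} {y} le yx = case InRx? R x y of λ where
    (yes xy) → xy
    (no ¬xy) → contradiction le (ℕP.<⇒≱
      (count-mono-< (λ z → ¬? (InRx? R y z)) (λ z → ¬? (InRx? R x z))
        (λ ¬yz xz → ¬yz (InRx-trans yx xz))
        (λ e ¬p p → ¬p (InRx-resp y (R.sym e) p))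
        (λ e ¬p p → ¬p (InRx-resp x (R.sym e) p))
        y ¬xy (λ ¬yy → ¬yy (InRx-refl y))))

  module _ (h : Carrier → ℚ) (h-Rx : ∀ x → ∑ R.elems (λ y → ⟦ InRx? R x y ⟧ * h y) ≡ 0ℚ) where

    -- Induction hypothesis on the size of D. Closure under left multiplication alone says that D is
    -- a union of principal left ideals; additive closure would be lost on deleting generators.
    VanishesBelow : ℕ → Set₁
    VanishesBelow k = {D : Pred Carrier 0ℓ} (D? : Decidable D) → D Respects _≈_ →
      (∀ r {x} → D x → D (r R.* x)) → count D? ℕ.< k → ∑ R.elems (λ x → ⟦ D? x ⟧ * h x) ≡ 0ℚ

    -- Let Rm be maximal in D. The elements of D that do not generate Rm, and those of Rm that do not,
    -- again form unions of left ideals, so only the generators of Rm contribute to either sum.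
    module _ {D : Pred Carrier 0ℓ} (D? : Decidable D) (D-resp : D Respects _≈_)
             (D-* : ∀ r {x} → D x → D (r R.* x)) (m : Carrier) (Dm : D m)
             (maximal : ∀ y → D y → InRx R y m → InRx R m y) (vanishes : VanishesBelow (count D?)) where
      private
        Gen : Pred Carrier 0ℓ
        Gen z = InRx R m z × InRx R z m

        Gen? : Decidable Gen
        Gen? z = InRx? R m z ×-dec InRx? R z m

        Gen-resp : Gen Respects _≈_
        Gen-resp e (p , q) = InRx-resp m e p , InRx-respˡ e q

        Rm⊆D : ∀ {x} → InRx R m x → D x
        Rm⊆D (r , x≈rm) = D-resp (R.sym x≈rm) (D-* r Dm)

        only-generators : {E : Pred Carrier 0ℓ} (E? : Decidable E) → E Respects _≈_ →
          (∀ r {x} → E x → E (r R.* x)) → E ⊆ D → Gen ⊆ E →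
          ∑ R.elems (λ x → ⟦ E? x ⟧ * h x) ≡ ∑ R.elems (λ x → ⟦ Gen? x ⟧ * h x)
        only-generators {E} E? E-resp E-* E⊆D Gen⊆E = begin
          ∑ R.elems (λ x → ⟦ E? x ⟧ * h x)
            ≡⟨ ∑-cong R.elems (λ x → trans (cong (λ s → s * h x) (⟦⟧-split (E? x) (Gen? x) Gen⊆E))
                 (ℚP.*-distribʳ-+ (h x) ⟦ Rest? x ⟧ ⟦ Gen? x ⟧)) ⟩
          ∑ R.elems (λ x → ⟦ Rest? x ⟧ * h x + ⟦ Gen? x ⟧ * h x)
            ≡⟨ ∑-+ R.elems _ _ ⟩
          ∑ R.elems (λ x → ⟦ Rest? x ⟧ * h x) + ∑ R.elems (λ x → ⟦ Gen? x ⟧ * h x)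
            ≡⟨ cong (λ s → s + ∑ R.elems (λ x → ⟦ Gen? x ⟧ * h x))
                 (vanishes Rest? Rest-resp Rest-* rest-smaller) ⟩
          0ℚ + ∑ R.elems (λ x → ⟦ Gen? x ⟧ * h x)
            ≡⟨ ℚP.+-identityˡ _ ⟩
          ∑ R.elems (λ x → ⟦ Gen? x ⟧ * h x) ∎
          where
          open ≡-Reasoning
          Rest : Pred Carrier 0ℓ
          Rest x = E x × ¬ Gen x
          Rest? : Decidable Rest
          Rest? x = E? x ×-dec ¬? (Gen? x)
          Rest-resp : Rest Respects _≈_
          Rest-resp e (Ex , ¬g) = E-resp e Ex , λ g → ¬g (Gen-resp (R.sym e) g)
          Rest-* : ∀ r {x} → Rest x → Rest (r R.* x)
          -- If `r * x` generated Rm, then m would lie in Rx; maximality of Rm then puts x in Rm,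
          -- making x itself a generator.
          Rest-* r {x} (Ex , ¬g) = E-* r Ex , λ (_ , rxm) →
            let xm = InRx-trans (InRx-* r (InRx-refl x)) rxm in ¬g (maximal x (E⊆D Ex) xm , xm)
          rest-smaller : count Rest? ℕ.< count D?
          rest-smaller = count-mono-< Rest? D? (λ (Ex , _) → E⊆D Ex) Rest-resp D-resp m Dm
            (λ (_ , ¬g) → ¬g (InRx-refl m , InRx-refl m))

      ∑-union-of-ideals-step : ∑ R.elems (λ x → ⟦ D? x ⟧ * h x) ≡ 0ℚ
      ∑-union-of-ideals-step = trans (only-generators D? D-resp D-* id (λ (mx , _) → Rm⊆D mx))
        (trans (sym (only-generators (InRx? R m) (InRx-resp m) (λ r → InRx-* r) Rm⊆D proj₁)) (h-Rx m))

    vanishesBelow : ∀ k → VanishesBelow k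
    vanishesBelow (suc k) D? D-resp D-* (ℕ.s≤s |D|≤k) = case ∃? D? D-resp of λ where
      (no ¬D) → ∑-zero R.elems λ x →
        trans (cong (λ s → s * h x) (⟦⟧-no (D? x) (λ Dx → ¬D (x , Dx)))) (ℚP.*-zeroˡ (h x))
      (yes ∃D) → case minimum D? D-resp cocount cocount-cong ∃D of λ
        (m , Dm , least) → ∑-union-of-ideals-step D? D-resp D-* m Dm
          (λ y Dy → cocount-least⇒maximal (least y Dy))
          (λ E? E-resp E-* |E|<|D| → vanishesBelow k E? E-resp E-* (ℕP.<-≤-trans |E|<|D| |D|≤k))

    ∑-union-of-ideals : {D : Pred Carrier 0ℓ} (D? : Decidable D) → D Respects _≈_ →
      (∀ r {x} → D x → D (r R.* x)) → ∑ R.elems (λ x → ⟦ D? x ⟧ * h x) ≡ 0ℚ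
    ∑-union-of-ideals D? D-resp D-* = vanishesBelow (suc (count D?)) D? D-resp D-* ℕP.≤-refl

  module _ (frobenius : IsFrobenius R) (w : Carrier → ℚ) (γ : ℚ) (w-hom : IsHomogeneousWeight R w γ) where
    open Character (proj₁ frobenius) (proj₁ (proj₂ frobenius))

    w-0# : w 0# ≡ 0ℚ
    w-0# = proj₁ w-hom

    w-cong : ∀ {x y} → x ≈ y → w x ≡ w y
    w-cong x≈y = proj₁ (proj₂ w-hom) _ _ λ z → InRx-respˡ x≈y , InRx-respˡ (R.sym x≈y)

    private
      χ-nontrivial : ∀ {I} → IsLeftIdeal R I → Nonzero R I → ¬ KerContains R (proj₁ frobenius) I
      χ-nontrivial {I} = proj₁ (proj₂ (proj₂ frobenius)) I

      -- Over the zero ideal `γ - w` sums to γ. The term `γ * ψ (ρ x)` cancels this while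
      -- contributing nothing over a nonzero left ideal, so h sums to zero over every Rx, including
      -- R0.
      h : Carrier → ℚ
      h x = γ - w x - γ * ψ (ρ x)

      ∑-h : {D : Pred Carrier 0ℓ} (D? : Decidable D) →
        ∑ R.elems (λ x → ⟦ D? x ⟧ * h x) ≡
          γ * ι (count D?) - ∑ R.elems (λ x → ⟦ D? x ⟧ * w x) - γ * ∑ R.elems (λ x → ⟦ D? x ⟧ * ψ (ρ x))
      ∑-h D? = begin
        ∑ R.elems (λ x → ⟦ D? x ⟧ * h x)
          ≡⟨ ∑-cong R.elems (λ x → solve 4 (λ d g a b → d :* (g :- a :- g :* b) :=
               g :* d :+ ((:- con 1ℚ) :* (d :* a) :+ (:- g) :* (d :* b))) refl ⟦ D? x ⟧ γ (w x) (ψ (ρ x))) ⟩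
        ∑ R.elems (λ x → γ * ⟦ D? x ⟧ + (- 1ℚ * (⟦ D? x ⟧ * w x) + - γ * (⟦ D? x ⟧ * ψ (ρ x))))
          ≡⟨ trans (∑-+ R.elems _ _) (cong₂ _+_ (trans (∑-*ˡ R.elems γ _) (cong (λ s → γ * s) (sym (ι-count D?))))
               (trans (∑-+ R.elems _ _) (cong₂ _+_ (∑-*ˡ R.elems (- 1ℚ) _) (∑-*ˡ R.elems (- γ) _)))) ⟩
        γ * ι (count D?) + (- 1ℚ * W + - γ * E)
          ≡⟨ solve 4 (λ g c a b → g :* c :+ ((:- con 1ℚ) :* a :+ (:- g) :* b) := g :* c :- a :- g :* b)
               refl γ (ι (count D?)) W E ⟩
        γ * ι (count D?) - W - γ * E ∎
        where
        open ≡-Reasoning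
        W = ∑ R.elems (λ x → ⟦ D? x ⟧ * w x)
        E = ∑ R.elems (λ x → ⟦ D? x ⟧ * ψ (ρ x))

      ∑-zeroIdeal : {D : Pred Carrier 0ℓ} (D? : Decidable D) → D 0# → D Respects _≈_ → (∀ {x} → D x → x ≈ 0#) →
        (f : Carrier → ℚ) → (∀ {x y} → x ≈ y → f x ≡ f y) →
        ∑ R.elems (λ x → ⟦ D? x ⟧ * f x) ≡ f 0#
      ∑-zeroIdeal D? D0 D-resp D⊆0 f f-cong = trans
        (∑-cong R.elems (λ x → cong (λ s → s * f x) (⟦⟧-cong (D? x) (x R.≟ 0#) D⊆0 (λ e → D-resp (R.sym e) D0))))
        (∑-δ-* f f-cong 0#)

      h-R0 : ∀ {x} → x ≈ 0# → ∑ R.elems (λ y → ⟦ InRx? R x y ⟧ * h y) ≡ 0ℚ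
      h-R0 {x} x≈0 = begin
        ∑ R.elems (λ y → ⟦ InRx? R x y ⟧ * h y)
          ≡⟨ ∑-zeroIdeal (InRx? R x) (IsLeftIdeal.has0 (InRx-isLeftIdeal x)) (InRx-resp x)
               (λ (r , y≈rx) → R.trans y≈rx (R.trans (R.*-congˡ x≈0) (R.zeroʳ r))) h
               (λ e → cong₂ (λ a b → γ - a - γ * ψ b) (w-cong e) (ρ-cong e)) ⟩
        γ - w 0# - γ * ψ (ρ 0#)
          ≡⟨ cong₂ (λ a b → γ - a - γ * b) w-0# (trans (cong ψ ρ-0#) ψ-0) ⟩
        γ - 0ℚ - γ * 1ℚ
          ≡⟨ solve 1 (λ g → g :- con 0ℚ :- g :* con 1ℚ := con 0ℚ) refl γ ⟩
        0ℚ ∎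
        where open ≡-Reasoning

      h-R≢0 : ∀ {x} → ¬ (x ≈ 0#) → ∑ R.elems (λ y → ⟦ InRx? R x y ⟧ * h y) ≡ 0ℚ
      h-R≢0 {x} x≉0 = begin
        ∑ R.elems (λ y → ⟦ InRx? R x y ⟧ * h y)
          ≡⟨ ∑-h (InRx? R x) ⟩
        γ * ι (cardRx R x) - ∑ R.elems (λ y → ⟦ InRx? R x y ⟧ * w y) - γ * ∑ R.elems (λ y → ⟦ InRx? R x y ⟧ * ψ (ρ y))
          ≡⟨ cong₂ (λ a b → γ * ι (cardRx R x) - a - γ * b)
               (trans (sym (∑-filter (InRx? R x) R.elems w)) (proj₂ (proj₂ w-hom) x x≉0))
               (∑-ideal-ψ (InRx? R x) (InRx-isLeftIdeal x) (χ-nontrivial (InRx-isLeftIdeal x) (x , InRx-refl x , x≉0))) ⟩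
        γ * ι (cardRx R x) - γ * ι (cardRx R x) - γ * 0ℚ
          ≡⟨ solve 2 (λ g c → g :* c :- g :* c :- g :* con 0ℚ := con 0ℚ) refl γ (ι (cardRx R x)) ⟩
        0ℚ ∎
        where open ≡-Reasoning

      h-Rx : ∀ x → ∑ R.elems (λ y → ⟦ InRx? R x y ⟧ * h y) ≡ 0ℚ
      h-Rx x = case x R.≟ 0# of λ where
        (yes x≈0) → h-R0 x≈0
        (no x≉0)  → h-R≢0 x≉0

    module _ {I : Pred Carrier 0ℓ} (I? : Decidable I) (I-ideal : IsLeftIdeal R I) where
      open IsLeftIdeal I-ideal

      -- An ideal is the union of the principal ideals of its elements, so h sums to zero over it;
      -- the ψ-part vanishes separately because I is nonzero, and what remains is the claim.
      ∑-ideal : Nonzero R I → ∑ R.elems (λ x → ⟦ I? x ⟧ * w x) ≡ γ * ι (count I?)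
      ∑-ideal I≢0 = begin
        W
          ≡⟨ solve 3 (λ a g c → a := (g :* c) :- (g :* c :- a :- g :* con 0ℚ)) refl W γ (ι (count I?)) ⟩
        γ * ι (count I?) - (γ * ι (count I?) - W - γ * 0ℚ)
          ≡⟨ cong (λ s → γ * ι (count I?) - (γ * ι (count I?) - W - γ * s)) (∑-ideal-ψ I? I-ideal (χ-nontrivial I-ideal I≢0)) ⟨
        γ * ι (count I?) - (γ * ι (count I?) - W - γ * ∑ R.elems (λ x → ⟦ I? x ⟧ * ψ (ρ x)))
          ≡⟨ cong (λ s → γ * ι (count I?) - s) (trans (sym (∑-h I?)) (∑-union-of-ideals h h-Rx I? resp *-cl)) ⟩
        γ * ι (count I?) - 0ℚ                    ≡⟨ ℚP.+-identityʳ _ ⟩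
        γ * ι (count I?)                         ∎
        where
        open ≡-Reasoning
        W = ∑ R.elems (λ x → ⟦ I? x ⟧ * w x)

      -- The inequality absorbs the zero ideal, which arises from coordinates at which the whole
      -- code vanishes and has weight sum 0.
      ∑-ideal-≤ : 0ℚ ≤ γ → ∑ R.elems (λ x → ⟦ I? x ⟧ * w x) ≤ γ * ι (count I?)
      ∑-ideal-≤ 0≤γ = case ∃? (λ x → I? x ×-dec ¬? (x R.≟ 0#))
                              (λ e (Ix , x≉0) → resp e Ix , λ y≈0 → x≉0 (R.trans e y≈0)) of λ
        { (yes I≢0) → ℚP.≤-reflexive (∑-ideal I≢0)
        ; (no I≡0)  → ∑-I-zero I≡0
        }
        where
        open ℚP.≤-Reasoning
        ∑-I-zero : ¬ Nonzero R I → ∑ R.elems (λ x → ⟦ I? x ⟧ * w x) ≤ γ * ι (count I?)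
        ∑-I-zero I≡0 = begin
          ∑ R.elems (λ x → ⟦ I? x ⟧ * w x) ≡⟨ ∑-zeroIdeal I? has0 resp I⊆0′ w w-cong ⟩
          w 0#                             ≡⟨ w-0# ⟩
          0ℚ                               ≡⟨ ℚP.*-zeroʳ γ ⟨
          γ * ι 0
            ≤⟨ ℚP.*-monoˡ-≤-nonNeg γ {{ℚ.nonNegative 0≤γ}} (ι-mono-≤ {0} {count I?} ℕ.z≤n) ⟩
          γ * ι (count I?)                 ∎
          where
          I⊆0′ : ∀ {x} → I x → x ≈ 0#
          I⊆0′ {x} Ix = decidable-stable (x R.≟ 0#) λ x≉0 → I≡0 (x , Ix , x≉0)

-- Words, cyclic codes Rc and coordinate projections

module Words (R : FiniteRing) where
  private module R = FiniteRing R
  open R using (Carrier; _≈_; 0#; 1#)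
  open import Algebra.Properties.Ring R.ring using (-1*x≈-x)

  infix 4 _≋_
  _≋_ : ∀ {n} → Word R n → Word R n → Set
  _≋_ = _≈ᵥ_ R

  ≋-refl : ∀ {n} {u : Word R n} → u ≋ u
  ≋-refl {u = []}    = _
  ≋-refl {u = x ∷ u} = R.refl , ≋-refl

  ≋-sym : ∀ {n} {u v : Word R n} → u ≋ v → v ≋ u
  ≋-sym {u = []}    {[]}    _       = _
  ≋-sym {u = x ∷ u} {y ∷ v} (e , p) = R.sym e , ≋-sym p

  ≋-trans : ∀ {n} {u v w : Word R n} → u ≋ v → v ≋ w → u ≋ w
  ≋-trans {u = []}    {[]}    {[]}    _       _       = _
  ≋-trans {u = x ∷ u} {y ∷ v} {z ∷ w} (e , p) (f , q) = R.trans e f , ≋-trans p q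

  +ᵥ-cong : ∀ {n} {u u′ v v′ : Word R n} → u ≋ u′ → v ≋ v′ → _+ᵥ_ R u v ≋ _+ᵥ_ R u′ v′
  +ᵥ-cong {u = []}    {[]}     {[]}    {[]}     _       _       = _
  +ᵥ-cong {u = _ ∷ _} {_ ∷ _} {_ ∷ _} {_ ∷ _} (e , p) (f , q) = R.+-cong e f , +ᵥ-cong p q

  +ᵥ-assoc : ∀ {n} (u v w : Word R n) → _+ᵥ_ R (_+ᵥ_ R u v) w ≋ _+ᵥ_ R u (_+ᵥ_ R v w)
  +ᵥ-assoc []      []      []      = _
  +ᵥ-assoc (x ∷ u) (y ∷ v) (z ∷ w) = R.+-assoc x y z , +ᵥ-assoc u v w

  +ᵥ-comm : ∀ {n} (u v : Word R n) → _+ᵥ_ R u v ≋ _+ᵥ_ R v u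
  +ᵥ-comm []      []      = _
  +ᵥ-comm (x ∷ u) (y ∷ v) = R.+-comm x y , +ᵥ-comm u v

  +ᵥ-identityˡ : ∀ {n} (u : Word R n) → _+ᵥ_ R (zeroᵥ R n) u ≋ u
  +ᵥ-identityˡ []      = _
  +ᵥ-identityˡ (x ∷ u) = R.+-identityˡ x , +ᵥ-identityˡ u

  -ᵥ_ : ∀ {n} → Word R n → Word R n
  -ᵥ_ = Vec.map (R.-_)

  -ᵥ-cong : ∀ {n} {u v : Word R n} → u ≋ v → -ᵥ u ≋ -ᵥ v
  -ᵥ-cong {u = []}    {[]}    _       = _
  -ᵥ-cong {u = x ∷ u} {y ∷ v} (e , p) = R.-‿cong e , -ᵥ-cong p

  -ᵥ-inverseˡ : ∀ {n} (u : Word R n) → _+ᵥ_ R (-ᵥ u) u ≋ zeroᵥ R n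
  -ᵥ-inverseˡ []      = _
  -ᵥ-inverseˡ (x ∷ u) = R.-‿inverseˡ x , -ᵥ-inverseˡ u

  -1·ᵥ : ∀ {n} (u : Word R n) → _·ᵥ_ R (R.- 1#) u ≋ -ᵥ u
  -1·ᵥ []      = _
  -1·ᵥ (x ∷ u) = -1*x≈-x x , -1·ᵥ u

  ·ᵥ-distribʳ : ∀ {n} r s (u : Word R n) → _·ᵥ_ R (r R.+ s) u ≋ _+ᵥ_ R (_·ᵥ_ R r u) (_·ᵥ_ R s u)
  ·ᵥ-distribʳ r s []      = _
  ·ᵥ-distribʳ r s (x ∷ u) = R.distribʳ x r s , ·ᵥ-distribʳ r s u

  ·ᵥ-assoc : ∀ {n} r s (u : Word R n) → _·ᵥ_ R (r R.* s) u ≋ _·ᵥ_ R r (_·ᵥ_ R s u)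
  ·ᵥ-assoc r s []      = _
  ·ᵥ-assoc r s (x ∷ u) = R.*-assoc r s x , ·ᵥ-assoc r s u

  ·ᵥ-cong : ∀ {n} r {u v : Word R n} → u ≋ v → _·ᵥ_ R r u ≋ _·ᵥ_ R r v
  ·ᵥ-cong r {[]}    {[]}    _       = _
  ·ᵥ-cong r {x ∷ u} {y ∷ v} (e , p) = R.*-congˡ e , ·ᵥ-cong r p

  0·ᵥ : ∀ {n} (u : Word R n) → _·ᵥ_ R 0# u ≋ zeroᵥ R n
  0·ᵥ []      = _
  0·ᵥ (x ∷ u) = R.zeroˡ x , 0·ᵥ u

  1·ᵥ : ∀ {n} (u : Word R n) → _·ᵥ_ R 1# u ≋ u
  1·ᵥ []      = _
  1·ᵥ (x ∷ u) = R.*-identityˡ x , 1·ᵥ u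

  lookup-cong : ∀ {n} {u v : Word R n} → u ≋ v → ∀ i → Vec.lookup u i ≈ Vec.lookup v i
  lookup-cong {u = x ∷ u} {y ∷ v} (e , p) Fin.zero    = e
  lookup-cong {u = x ∷ u} {y ∷ v} (e , p) (Fin.suc i) = lookup-cong p i

  ∑-elems-δ : ∀ a → ∑ R.elems (λ x → ⟦ x R.≟ a ⟧) ≡ 1ℚ
  ∑-elems-δ = FiniteAbelianGroup.∑-δ (RingTheory.additiveGroup R)

  -- The indicator of a word is the product of the indicators of its head and tail, so the sum
  -- factors.
  ∑-allWords-δ : ∀ n (a : Word R n) → ∑ (allWords R n) (λ v → ⟦ _≟ᵥ_ R v a ⟧) ≡ 1ℚ
  ∑-allWords-δ zero    []      = refl
  ∑-allWords-δ (suc n) (a ∷ b) = begin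
    ∑ (allWords R (suc n)) (λ v → ⟦ _≟ᵥ_ R v (a ∷ b) ⟧)
      ≡⟨ ∑-concatMap _ R.elems _ ⟩
    ∑ R.elems (λ x → ∑ (List.map (x ∷_) (allWords R n)) (λ v → ⟦ _≟ᵥ_ R v (a ∷ b) ⟧))
      ≡⟨ ∑-cong R.elems (λ x → ∑-map (x ∷_) (allWords R n) _) ⟩
    ∑ R.elems (λ x → ∑ (allWords R n) (λ v → ⟦ _≟ᵥ_ R (x ∷ v) (a ∷ b) ⟧))
      ≡⟨ ∑-cong R.elems (λ x → trans (∑-cong (allWords R n) (λ v → product x v))
           (trans (∑-*ˡ (allWords R n) ⟦ x R.≟ a ⟧ _) (cong (λ s → ⟦ x R.≟ a ⟧ * s) (∑-allWords-δ n b)))) ⟩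
    ∑ R.elems (λ x → ⟦ x R.≟ a ⟧ * 1ℚ)
      ≡⟨ ∑-pick R._≟_ R.elems a (∑-elems-δ a) (λ _ → 1ℚ) (λ _ → refl) ⟩
    1ℚ ∎
    where
    open ≡-Reasoning
    product : ∀ x v → ⟦ _≟ᵥ_ R (x ∷ v) (a ∷ b) ⟧ ≡ ⟦ x R.≟ a ⟧ * ⟦ _≟ᵥ_ R v b ⟧
    product x v = trans
      (⟦⟧-cong (_≟ᵥ_ R (x ∷ v) (a ∷ b)) ((x R.≟ a) ×-dec (_≟ᵥ_ R v b)) id id)
      (⟦⟧-×-dec (x R.≟ a) (_≟ᵥ_ R v b))

  wordGroup : ℕ → FiniteAbelianGroup
  wordGroup n = record
    { abelianGroup = record
      { Carrier = Word R n
      ; _≈_     = _≋_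
      ; _∙_     = _+ᵥ_ R
      ; ε       = zeroᵥ R n
      ; _⁻¹     = -ᵥ_
      ; isAbelianGroup = record
        { isGroup = record
          { isMonoid = record
            { isSemigroup = record
              { isMagma = record
                { isEquivalence = record { refl = ≋-refl ; sym = ≋-sym ; trans = ≋-trans }
                ; ∙-cong = +ᵥ-cong
                }
              ; assoc = +ᵥ-assoc
              }
            ; identity = +ᵥ-identityˡ ,
                (λ u → ≋-trans (+ᵥ-comm u (zeroᵥ R n)) (+ᵥ-identityˡ u))
            }
          ; inverse = -ᵥ-inverseˡ , (λ u → ≋-trans (+ᵥ-comm u (-ᵥ u)) (-ᵥ-inverseˡ u))
          ; ⁻¹-cong = -ᵥ-cong
          }
        ; comm = +ᵥ-comm
        }
      }
    ; _≟_   = _≟ᵥ_ R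
    ; elems = allWords R n
    ; ∑-δ   = ∑-allWords-δ n
    }

  weight-cong : {w : Carrier → ℚ} → (∀ {x y} → x ≈ y → w x ≡ w y) →
                ∀ {n} {u v : Word R n} → u ≋ v → weightᵥ R w u ≡ weightᵥ R w v
  weight-cong w-cong {u = []}    {[]}    _       = refl
  weight-cong w-cong {u = x ∷ u} {y ∷ v} (e , p) = cong₂ _+_ (w-cong e) (weight-cong w-cong p)

  weight-zeroᵥ : {w : Carrier → ℚ} → w 0# ≡ 0ℚ → ∀ n → weightᵥ R w (zeroᵥ R n) ≡ 0ℚ
  weight-zeroᵥ w0 zero    = refl
  weight-zeroᵥ w0 (suc n) = cong₂ _+_ w0 (weight-zeroᵥ w0 n)

  weight-∑ : (w : Carrier → ℚ) → ∀ {n} (v : Word R n) →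
             weightᵥ R w v ≡ ∑ (allFin n) (λ i → w (Vec.lookup v i))
  weight-∑ w []              = refl
  weight-∑ w {suc n} (x ∷ v) = cong (λ s → w x + s) (begin
    weightᵥ R w v                                              ≡⟨ weight-∑ w v ⟩
    ∑ (allFin n) (λ i → w (Vec.lookup v i))                    ≡⟨ ∑-map Fin.suc (allFin n) _ ⟨
    ∑ (List.map Fin.suc (allFin n)) (λ i → w (Vec.lookup (x ∷ v) i))
      ≡⟨ cong (λ is → ∑ is (λ i → w (Vec.lookup (x ∷ v) i))) (map-tabulate id Fin.suc) ⟩
    ∑ (List.tabulate Fin.suc) (λ i → w (Vec.lookup (x ∷ v) i)) ∎)
    where open ≡-Reasoning

  hamming<n⇒zero : ∀ {n} (v : Word R n) → hamming R v ℕ.< n → ∃ λ j → Vec.lookup v j ≈ 0#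
  hamming<n⇒zero (x ∷ v) lt with x R.≟ 0#
  ... | yes x≈0 = Fin.zero , x≈0
  ... | no _ with hamming<n⇒zero v (ℕ.s<s⁻¹ lt)
  ...   | j , e = Fin.suc j , e

  module _ {n : ℕ} where
    open FiniteGroupSums (wordGroup n)

    code⇒subgroup : ∀ {C} → IsLinearCode R n C → IsSubgroup C
    code⇒subgroup C-lin = record
      { resp = resp ; ε-mem = has0 ; ∙-mem = +-cl
      ; ⁻¹-mem = λ {u} Cu → resp (-1·ᵥ u) (·-cl (R.- 1#) Cu) }
      where open IsLinearCode C-lin

    InRc-isLinear : ∀ c → IsLinearCode R n (InRc R c)
    InRc-isLinear c = record
      { resp = λ u≋v (r , p) → r , ≋-trans (≋-sym u≋v) p
      ; has0 = 0# , ≋-sym (0·ᵥ c)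
      ; +-cl = λ (r , p) (s , q) → r R.+ s , ≋-trans (+ᵥ-cong p q) (≋-sym (·ᵥ-distribʳ r s c))
      ; ·-cl = λ r (s , q) → r R.* s , ≋-trans (·ᵥ-cong r q) (≋-sym (·ᵥ-assoc r s c))
      }

    InRc⊆C : ∀ {C c} → IsLinearCode R n C → C c → InRc R c ⊆ C
    InRc⊆C C-lin Cc (r , p) = resp (≋-sym p) (·-cl r Cc)
      where open IsLinearCode C-lin

    InRc-refl : (c : Word R n) → InRc R c c
    InRc-refl c = 1# , ≋-sym (1·ᵥ c)

    -- The zero word alone forms a set of size 1, properly contained in Rc since c itself lies
    -- there.
    cardRc≥2 : ∀ {c} → NonzeroWord R c → 2 ℕ.≤ cardRc R c
    cardRc≥2 {c} c≢0 = subst (ℕ._< cardRc R c) |0|≡1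
      (count-mono-< (λ v → _≟ᵥ_ R v (zeroᵥ R n)) (InRc? R c)
        (λ e → resp (≋-sym e) has0) (λ e p → ≋-trans (≋-sym e) p) resp c (InRc-refl c) c≢0)
      where
      open IsLinearCode (InRc-isLinear c)
      |0|≡1 : count (λ v → _≟ᵥ_ R v (zeroᵥ R n)) ≡ 1
      |0|≡1 = ι-injective (trans (ι-count _) (∑-allWords-δ n (zeroᵥ R n)))

    module Coordinate {C : Pred (Word R n) 0ℓ} (C? : Decidable C) (C-lin : IsLinearCode R n C) (i : Fin n) where
      open IsLinearCode C-lin

      coefficients : DecSetoid 0ℓ 0ℓ
      coefficients = record
        { isDecEquivalence = record { isEquivalence = R.isEquivalence ; _≟_ = R._≟_ } }

      private
        lookup-translate : ∀ (u v z : Word R n) → Vec.lookup u i ≈ Vec.lookup v i →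
          Vec.lookup (_+ᵥ_ R u z) i ≈ Vec.lookup (_+ᵥ_ R v z) i
        lookup-translate u v z e =
          subst₂ _≈_ (sym (lookup-zipWith R._+_ i u z)) (sym (lookup-zipWith R._+_ i v z)) (R.+-congʳ e)

      open Fibres C? (code⇒subgroup C-lin) coefficients R.elems (λ v → Vec.lookup v i)
        (λ e → lookup-cong e i) lookup-translate (λ v → ∑-elems-δ (Vec.lookup v i)) public

      image-isLeftIdeal : IsLeftIdeal R Im
      image-isLeftIdeal = record
        { resp = λ x≈y (v , Cv , e) → v , Cv , R.trans (R.sym x≈y) e
        ; has0 = zeroᵥ R n , has0 , R.reflexive (sym (lookup-replicate i 0#))
        ; +-cl = λ (u , Cu , e) (v , Cv , f) → _+ᵥ_ R u v , +-cl Cu Cv ,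
            R.trans (R.+-cong e f) (R.reflexive (sym (lookup-zipWith R._+_ i u v)))
        ; *-cl = λ r (v , Cv , e) → _·ᵥ_ R r v , ·-cl r Cv ,
            R.trans (R.*-congˡ e) (R.reflexive (sym (lookup-map i (r R.*_) v)))
        }

      VanishAt : Pred (Word R n) 0ℓ
      VanishAt v = C v × Vec.lookup v i ≈ 0#

      VanishAt? : Decidable VanishAt
      VanishAt? v = C? v ×-dec (Vec.lookup v i R.≟ 0#)

      VanishAt-isLinear : IsLinearCode R n VanishAt
      VanishAt-isLinear = record
        { resp = λ u≋v (Cu , e) → resp u≋v Cu , R.trans (R.sym (lookup-cong u≋v i)) e
        ; has0 = has0 , R.reflexive (lookup-replicate i 0#)
        ; +-cl = λ {u} {v} (Cu , e) (Cv , f) → +-cl Cu Cv ,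
            R.trans (R.reflexive (lookup-zipWith R._+_ i u v)) (R.trans (R.+-cong e f) (R.+-identityˡ 0#))
        ; ·-cl = λ r {v} (Cv , e) → ·-cl r Cv ,
            R.trans (R.reflexive (lookup-map i (r R.*_) v)) (R.trans (R.*-congˡ e) (R.zeroʳ r))
        }

      -- The code has |Ker| · |Im| elements for the projection to coordinate i; the kernel consists
      -- of words vanishing there, and the image sits in R.
      cardCode≤ : cardCode R C? ℕ.≤ count VanishAt? ℕ.* card R
      cardCode≤ = subst (ℕ._≤ count VanishAt? ℕ.* card R) (sym count-fibres)
        (ℕP.*-mono-≤
          (count-mono-≤ Ker? VanishAt? (λ (Cv , e) → Cv , R.trans e (R.reflexive (lookup-replicate i 0#))))
          (length-filter Im? R.elems))

-- The Plotkin bound for a code with a dead coordinate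

module Plotkin (R : FiniteRing) (frobenius : IsFrobenius R) (w : FiniteRing.Carrier R → ℚ) (γ : ℚ)
               (w-hom : IsHomogeneousWeight R w γ) (0≤γ : 0ℚ ≤ γ)
               {n : ℕ} {C : Pred (Word R n) 0ℓ} (C? : Decidable C) (C-lin : IsLinearCode R n C) where
  private module R = FiniteRing R
  open Words R
  open HomogeneousWeight R
  open FiniteGroupSums (wordGroup n)
  open IsLinearCode C-lin

  private
    N = cardCode R C?

  -- Every value in the coordinate's image, a left ideal, is taken equally often, namely |Ker|
  -- times; so the sum is at most |Ker| · γ|Im|, which is γN.
  ∑-coordinate-≤ : ∀ i → ∑ (allWords R n) (λ v → ⟦ C? v ⟧ * w (Vec.lookup v i)) ≤ γ * ι N
  ∑-coordinate-≤ i = begin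
    ∑ (allWords R n) (λ v → ⟦ C? v ⟧ * w (Vec.lookup v i))
      ≡⟨ ∑-fibres w (w-cong frobenius w γ w-hom) ⟩
    ι (count Ker?) * ∑ R.elems (λ x → ⟦ Im? x ⟧ * w x)
      ≤⟨ ℚP.*-monoˡ-≤-nonNeg (ι (count Ker?)) {{ℚ.nonNegative (ι-mono-≤ {0} {count Ker?} ℕ.z≤n)}}
           (∑-ideal-≤ frobenius w γ w-hom Im? image-isLeftIdeal 0≤γ) ⟩
    ι (count Ker?) * (γ * ι (length (filter Im? R.elems)))
      ≡⟨ solve 3 (λ a g b → a :* (g :* b) := g :* (a :* b)) refl (ι (count Ker?)) γ (ι (length (filter Im? R.elems))) ⟩
    γ * (ι (count Ker?) * ι (length (filter Im? R.elems)))
      ≡⟨ cong (λ s → γ * s) ι-count-fibres ⟨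
    γ * ι N ∎
    where
    open ℚP.≤-Reasoning
    open Coordinate C? C-lin i

  module _ (j : Fin n) (C-j : ∀ v → C v → R._≈_ (Vec.lookup v j) R.0#) where

    ∑-coordinate-j : ∑ (allWords R n) (λ v → ⟦ C? v ⟧ * w (Vec.lookup v j)) ≡ 0ℚ
    ∑-coordinate-j = ∑-zero (allWords R n) λ v → trans
      (⟦⟧-guard (C? v) (λ Cv → trans (w-cong frobenius w γ w-hom (C-j v Cv)) (w-0# frobenius w γ w-hom)))
      (ℚP.*-zeroʳ ⟦ C? v ⟧)

    ∑-weight-≤ : ∑ (allWords R n) (λ v → ⟦ C? v ⟧ * weightᵥ R w v) ≤ ι n * (γ * ι N) - γ * ι N
    ∑-weight-≤ = begin
      ∑ (allWords R n) (λ v → ⟦ C? v ⟧ * weightᵥ R w v)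
        ≡⟨ ∑-cong (allWords R n) (λ v → trans (cong (λ s → ⟦ C? v ⟧ * s) (weight-∑ w v))
             (sym (∑-*ˡ (allFin n) ⟦ C? v ⟧ _))) ⟩
      ∑ (allWords R n) (λ v → ∑ (allFin n) (λ i → ⟦ C? v ⟧ * w (Vec.lookup v i)))
        ≡⟨ ∑-swap (allWords R n) (allFin n) _ ⟩
      ∑ (allFin n) (λ i → ∑ (allWords R n) (λ v → ⟦ C? v ⟧ * w (Vec.lookup v i)))
        ≤⟨ ∑-mono (allFin n) bound ⟩
      ∑ (allFin n) (λ i → γ * ι N + - (γ * ι N) * ⟦ i FinP.≟ j ⟧)
        ≡⟨ trans (∑-+ (allFin n) _ _) (cong₂ _+_ (∑-const (allFin n) (γ * ι N)) (∑-*ˡ (allFin n) (- (γ * ι N)) _)) ⟩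
      ι (length (allFin n)) * (γ * ι N) + - (γ * ι N) * ∑ (allFin n) (λ i → ⟦ i FinP.≟ j ⟧)
        ≡⟨ cong₂ (λ l s → ι l * (γ * ι N) + - (γ * ι N) * s) (length-tabulate {n = n} id)
             (∑-indicator FinP._≟_ sym trans (allFin n) j (allFin⁺ n) (∈-allFin j)) ⟩
      ι n * (γ * ι N) + - (γ * ι N) * 1ℚ
        ≡⟨ cong (λ s → ι n * (γ * ι N) + s) (ℚP.*-identityʳ (- (γ * ι N))) ⟩
      ι n * (γ * ι N) - γ * ι N ∎
      where
      open ℚP.≤-Reasoning
      -- The indicator of j records the saving of one coordinate: the bound is 0 at j and γN
      -- elsewhere.
      bound : ∀ i → ∑ (allWords R n) (λ v → ⟦ C? v ⟧ * w (Vec.lookup v i)) ≤ γ * ι N + - (γ * ι N) * ⟦ i FinP.≟ j ⟧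
      bound i with i FinP.≟ j
      ... | yes refl = ℚP.≤-reflexive (trans ∑-coordinate-j
        (solve 1 (λ a → con 0ℚ := a :+ (:- a) :* con 1ℚ) refl (γ * ι N)))
      ... | no _ = ℚP.≤-trans (∑-coordinate-≤ i) (ℚP.≤-reflexive
        (solve 1 (λ a → a := a :+ (:- a) :* con 0ℚ) refl (γ * ι N)))

    -- All words of C but the zero word contribute at least d. The zero word is corrected by
    -- subtracting d times its indicator.
    ∑-weight-≥ : ∀ d → (∀ c → C c → NonzeroWord R c → d ≤ weightᵥ R w c) →
      ι N * d - d ≤ ∑ (allWords R n) (λ v → ⟦ C? v ⟧ * weightᵥ R w v)
    ∑-weight-≥ d d≤ = begin
      ι N * d - d
        ≡⟨ cong (λ s → ι N * d + s) (ℚP.*-identityʳ (- d)) ⟨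
      ι N * d + - d * 1ℚ
        ≡⟨ cong₂ (λ a b → a * d + - d * b) (sym (ι-count C?)) (∑-allWords-δ n (zeroᵥ R n)) ⟨
      ∑ (allWords R n) (λ v → ⟦ C? v ⟧) * d + - d * ∑ (allWords R n) (λ v → ⟦ _≟ᵥ_ R v (zeroᵥ R n) ⟧)
        ≡⟨ trans (∑-+ (allWords R n) _ _) (cong₂ _+_ (∑-*ʳ (allWords R n) _ d) (∑-*ˡ (allWords R n) (- d) _)) ⟨
      ∑ (allWords R n) (λ v → ⟦ C? v ⟧ * d + - d * ⟦ _≟ᵥ_ R v (zeroᵥ R n) ⟧)
        ≤⟨ ∑-mono (allWords R n) bound ⟩
      ∑ (allWords R n) (λ v → ⟦ C? v ⟧ * weightᵥ R w v) ∎
      where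
      open ℚP.≤-Reasoning
      bound : ∀ v → ⟦ C? v ⟧ * d + - d * ⟦ _≟ᵥ_ R v (zeroᵥ R n) ⟧ ≤ ⟦ C? v ⟧ * weightᵥ R w v
      bound v with C? v | _≟ᵥ_ R v (zeroᵥ R n)
      ... | yes _ | yes v≋0 = ℚP.≤-reflexive (trans
        (solve 1 (λ d → con 1ℚ :* d :+ (:- d) :* con 1ℚ := con 1ℚ :* con 0ℚ) refl d)
        (cong (λ s → 1ℚ * s) (sym (trans (weight-cong (w-cong frobenius w γ w-hom) v≋0)
          (weight-zeroᵥ (w-0# frobenius w γ w-hom) n)))))
      ... | yes Cv | no v≢0 = ℚP.≤-trans
        (ℚP.≤-reflexive (solve 1 (λ d → con 1ℚ :* d :+ (:- d) :* con 0ℚ := d) refl d))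
        (ℚP.≤-trans (d≤ v Cv v≢0) (ℚP.≤-reflexive (sym (ℚP.*-identityˡ _))))
      ... | no ¬Cv | yes v≋0 = contradiction (resp (≋-sym v≋0) has0) ¬Cv
      ... | no _ | no _ = ℚP.≤-reflexive
        (solve 2 (λ d a → con 0ℚ :* d :+ (:- d) :* con 0ℚ := con 0ℚ :* a) refl d (weightᵥ R w v))

    plotkin : ∀ d → (∀ c → C c → NonzeroWord R c → d ≤ weightᵥ R w c) →
      ι N * d - d ≤ ι n * (γ * ι N) - γ * ι N
    plotkin d d≤ = ℚP.≤-trans (∑-weight-≥ d d≤) ∑-weight-≤

-- Arithmetic: from the Plotkin bound to the bound on the scaled distance

p≤q⇒0≤q-p : ∀ {p q} → p ≤ q → 0ℚ ≤ q - p
p≤q⇒0≤q-p {p} {q} p≤q = subst (_≤ q - p) (ℚP.+-inverseʳ p) (ℚP.+-monoˡ-≤ (- p) p≤q)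

0≤q-p⇒p≤q : ∀ {p q} → 0ℚ ≤ q - p → p ≤ q
0≤q-p⇒p≤q {p} {q} h =
  subst₂ _≤_ (ℚP.+-identityˡ p) (solve 2 (λ p q → (q :- p) :+ p := q) refl p q) (ℚP.+-monoˡ-≤ p h)

0≤p*q : ∀ {p q} → 0ℚ ≤ p → 0ℚ ≤ q → 0ℚ ≤ p * q
0≤p*q {p} {q} 0≤p 0≤q = subst (_≤ p * q) (ℚP.*-zeroʳ p) (ℚP.*-monoˡ-≤-nonNeg p {{ℚ.nonNegative 0≤p}} 0≤q)

module _ {γ d : ℚ} (0<γ : 0ℚ < γ) {n P t : ℕ} .{{_ : NonZero P}} (2≤P : 2 ℕ.≤ P) (1≤t : 1 ℕ.≤ t)
         (γn≤d : γ * ι n ≤ d)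
         (plotkin : ι (P ℕ.* t) * d - d ≤ ι n * (γ * ι (P ℕ.* t)) - γ * ι (P ℕ.* t)) where
  private
    N = P ℕ.* t
    1≤P : 1 ℕ.≤ P
    1≤P = ℕP.≤-trans (ℕ.s≤s ℕ.z≤n) 2≤P
    2≤N : 2 ℕ.≤ N
    2≤N = ℕP.*-mono-≤ 2≤P 1≤t
    0≤ι-1 : ∀ {m} → 1 ℕ.≤ m → 0ℚ ≤ ι m - 1ℚ
    0≤ι-1 {m} 1≤m = p≤q⇒0≤q-p (ι-mono-≤ 1≤m)

  -- N - 1 times the slack `d - γ * ι n`, added to the slack in `plotkin`, equals γ(n - N): all
  -- terms with d cancel.
  N≤n : N ℕ.≤ n
  N≤n = ι-cancel-≤ (ℚP.*-cancelˡ-≤-pos γ {{ℚ.positive 0<γ}} (0≤q-p⇒p≤q (subst (0ℚ ≤_)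
    (solve 4 (λ M g m d → (M :- con 1ℚ) :* (d :- g :* m) :+ ((m :* (g :* M) :- g :* M) :- (M :* d :- d))
        := g :* m :- g :* M) refl (ι N) γ (ι n) d)
    (ℚP.+-mono-≤ (0≤p*q (0≤ι-1 (ℕP.≤-trans (ℕ.s≤s ℕ.z≤n) 2≤N)) (p≤q⇒0≤q-p γn≤d)) (p≤q⇒0≤q-p plotkin)))))

  -- Multiply through by Pγ(N − 1) and use Plotkin; with N = Pt the remaining difference is γP(t − 1)(n − N).
  scaled-distance-≤ : ((+ (P ∸ 1)) ℚ./ P) * (ℚ._÷_ d γ {{ℚP.pos⇒nonZero γ {{ℚ.positive 0<γ}}}}) ≤ fromℤ ((+ n) ℤ.- (+ t))
  scaled-distance-≤ = ℚP.*-cancelʳ-≤-pos F {{ℚ.positive 0<F}} (0≤q-p⇒p≤q (subst (0ℚ ≤_) difference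
    (ℚP.+-mono-≤
      (0≤p*q (0≤ι-1 1≤P) (p≤q⇒0≤q-p plotkin))
      (0≤p*q (0≤p*q (ℚP.<⇒≤ 0<γ) (ι-mono-≤ {0} {P} ℕ.z≤n)) (0≤p*q (0≤ι-1 1≤t) (p≤q⇒0≤q-p (ι-mono-≤ N≤n)))))))
    where
    instance
      γ≢0 : ℚ.NonZero γ
      γ≢0 = ℚP.pos⇒nonZero γ {{ℚ.positive 0<γ}}
    q = (+ (P ∸ 1)) ℚ./ P
    F = ι P * (γ * (ι N - 1ℚ))
    0<F : 0ℚ < F
    0<F = ℚP.positive⁻¹ F {{ℚP.pos*pos⇒pos (ι P) {{ℚ.positive (fromℤ-mono-< (ℤ.+<+ 1≤P))}} (γ * (ι N - 1ℚ))
            {{ℚP.pos*pos⇒pos γ {{ℚ.positive 0<γ}} (ι N - 1ℚ) {{ℚ.positive 0<N-1}}}}}}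
      where
      0<N-1 : 0ℚ < ι N - 1ℚ
      0<N-1 = ℚP.+-monoˡ-< (- 1ℚ) {1ℚ} {ι N} (fromℤ-mono-< (ℤ.+<+ 2≤N))
    qP : q * ι P ≡ ι P - 1ℚ
    qP = trans (fraction-* (+ (P ∸ 1)) P) (begin
      ι (P ∸ 1)                ≡⟨ solve 1 (λ a → a := (con 1ℚ :+ a) :- con 1ℚ) refl (ι (P ∸ 1)) ⟩
      (1ℚ + ι (P ∸ 1)) - 1ℚ
        ≡⟨ cong (λ s → s - 1ℚ) (trans (sym (ι-+ 1 (P ∸ 1))) (cong ι (ℕP.m+[n∸m]≡n 1≤P))) ⟩
      ι P - 1ℚ                 ∎)
      where open ≡-Reasoning
    lhs : q * (d ℚ.÷ γ) * F ≡ (ι P - 1ℚ) * (ι N * d - d)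
    lhs = begin
      q * (d * ℚ.1/ γ) * (ι P * (γ * (ι N - 1ℚ)))
        ≡⟨ solve 6 (λ q d i p g m → q :* (d :* i) :* (p :* (g :* (m :- con 1ℚ))) :=
             (q :* p) :* (i :* g) :* (m :* d :- d)) refl q d (ℚ.1/ γ) (ι P) γ (ι N) ⟩
      (q * ι P) * (ℚ.1/ γ * γ) * (ι N * d - d)
        ≡⟨ cong₂ (λ a b → a * b * (ι N * d - d)) qP (ℚP.*-inverseˡ γ) ⟩
      (ι P - 1ℚ) * 1ℚ * (ι N * d - d)
        ≡⟨ cong (λ s → s * (ι N * d - d)) (ℚP.*-identityʳ (ι P - 1ℚ)) ⟩
      (ι P - 1ℚ) * (ι N * d - d) ∎
      where open ≡-Reasoning
    rhs : fromℤ ((+ n) ℤ.- (+ t)) ≡ ι n - ι t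
    rhs = trans (fromℤ-+ (+ n) (ℤ.- (+ t))) (cong (λ s → ι n + s) (sym (fromℤ-neg (+ t))))
    difference : (ι P - 1ℚ) * ((ι n * (γ * ι N) - γ * ι N) - (ι N * d - d)) + γ * ι P * ((ι t - 1ℚ) * (ι n - ι N))
               ≡ fromℤ ((+ n) ℤ.- (+ t)) * F - q * (d ℚ.÷ γ) * F
    difference = begin
      (ι P - 1ℚ) * ((ι n * (γ * ι N) - γ * ι N) - (ι N * d - d)) + γ * ι P * ((ι t - 1ℚ) * (ι n - ι N))
        -- N is expanded to Pt everywhere except in `ι N * d - d`, which the solver treats as the
        -- single atom x, matching its form in `lhs`.
        ≡⟨ cong (λ M → (ι P - 1ℚ) * ((ι n * (γ * M) - γ * M) - (ι N * d - d)) + γ * ι P * ((ι t - 1ℚ) * (ι n - M))) (ι-* P t) ⟩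
      (ι P - 1ℚ) * ((ι n * (γ * (ι P * ι t)) - γ * (ι P * ι t)) - (ι N * d - d)) + γ * ι P * ((ι t - 1ℚ) * (ι n - ι P * ι t))
        ≡⟨ solve 5 (λ p m g t x → (p :- con 1ℚ) :* ((m :* (g :* (p :* t)) :- g :* (p :* t)) :- x) :+ g :* p :* ((t :- con 1ℚ) :* (m :- p :* t))
             := (m :- t) :* (p :* (g :* (p :* t :- con 1ℚ))) :- (p :- con 1ℚ) :* x) refl (ι P) (ι n) γ (ι t) (ι N * d - d) ⟩
      (ι n - ι t) * (ι P * (γ * (ι P * ι t - 1ℚ))) - (ι P - 1ℚ) * (ι N * d - d)
        ≡⟨ cong (λ M → (ι n - ι t) * (ι P * (γ * (M - 1ℚ))) - (ι P - 1ℚ) * (ι N * d - d)) (ι-* P t) ⟨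
      (ι n - ι t) * F - (ι P - 1ℚ) * (ι N * d - d)
        ≡⟨ cong₂ (λ a b → a * F - b) (sym rhs) (sym lhs) ⟩
      fromℤ ((+ n) ℤ.- (+ t)) * F - q * (d ℚ.÷ γ) * F ∎
      where open ≡-Reasoning

-- Powers and the ceiling of a logarithm

m*n≤m^n : ∀ m n → 2 ℕ.≤ m → 1 ℕ.≤ n → m ℕ.* n ℕ.≤ m ℕ.^ n
m*n≤m^n m (suc n) 2≤m _ = ℕP.*-monoʳ-≤ m (1+n≤m^n n)
  where
  1+n≤m^n : ∀ n → suc n ℕ.≤ m ℕ.^ n
  1+n≤m^n zero    = ℕP.≤-refl
  1+n≤m^n (suc n) = begin
    suc (suc n)         ≤⟨ ℕP.+-mono-≤ (ℕ.s≤s (ℕ.z≤n {n})) (1+n≤m^n n) ⟩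
    suc n ℕ.+ m ℕ.^ n   ≤⟨ ℕP.+-monoˡ-≤ (m ℕ.^ n) (1+n≤m^n n) ⟩
    m ℕ.^ n ℕ.+ m ℕ.^ n ≡⟨ cong (m ℕ.^ n ℕ.+_) (ℕP.+-identityʳ (m ℕ.^ n)) ⟨
    2 ℕ.* m ℕ.^ n       ≤⟨ ℕP.*-monoˡ-≤ (m ℕ.^ n) 2≤m ⟩
    m ℕ.* m ℕ.^ n       ∎
    where open ℕP.≤-Reasoning

powℤ-mono-≤ : ∀ P .{{_ : NonZero P}} {t z} → + t ℤ.≤ z → ι (P ℕ.^ t) ≤ powℤ P z
powℤ-mono-≤ P (ℤ.+≤+ t≤m) = ι-mono-≤ (ℕP.^-monoʳ-≤ P t≤m)

-- If t < k then t ≤ k - 1, so x ≤ P^t ≤ P^(k-1) < x. The exponent k - 1 is then nonnegative, hence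
-- monotonicity of `powℤ` is only called for there.
ceilLog-≤ : ∀ P .{{_ : NonZero P}} {x k t} → IsCeilLog P x k → x ≤ ι (P ℕ.^ t) → k ℤ.≤ + t
ceilLog-≤ P {x} {k} {t} (below , _) x≤ = ℤP.≮⇒≥ λ t<k →
  ℚP.<-irrefl refl (ℚP.<-≤-trans below (ℚP.≤-trans x≤ (powℤ-mono-≤ P
    (subst (+ t ℤ.≤_) (ℤP.+-comm (ℤ.- (+ 1)) k) (ℤP.i<j⇒i≤pred[j] t<k)))))

fraction-≤ : ∀ {a b m} .{{_ : NonZero b}} → a ℕ.≤ m ℕ.* b → (+ a) ℚ./ b ≤ ι m
fraction-≤ {a} {b} {m} a≤mb = ℚP.*-cancelʳ-≤-pos (ι b) {{ℚ.positive (fromℤ-mono-< (ℤ.+<+ (ℕ.>-nonZero⁻¹ b)))}}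
  (subst₂ _≤_ (sym (fraction-* (+ a) b)) (ι-* m b) (ι-mono-≤ a≤mb))

-- The bound for the original code, via the subcode vanishing at a zero of c

theorem2 : (R : FiniteRing) → IsFrobenius R
    → (w : FiniteRing.Carrier R → ℚ) (γ : ℚ) (γ>0 : ℚ.0ℚ ℚ.< γ)
    → IsHomogeneousWeight R w γ
    → (n : ℕ) (C : Pred (Word R n) 0ℓ) (C? : Decidable C) → IsLinearCode R n C
    → (d : ℚ)
    → (∃ λ c → C c × NonzeroWord R c × weightᵥ R w c ≡ d)
    → (∀ c → C c → NonzeroWord R c → d ℚ.≤ weightᵥ R w c)
    → γ ℚ.* ((+ n) ℚ./ 1) ℚ.≤ d
    → (∃ λ c → C c × NonzeroWord R c × hamming R c ℕ.< n)
    → (P : ℕ) .{{_ : NonZero P}}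
    → (∃ λ c → C c × hamming R c ℕ.< n × cardRc R c ≡ P)
    → (∀ c → C c → hamming R c ℕ.< n → cardRc R c ℕ.≤ P)
    → (k : ℤ)
    → IsCeilLog P (((+ cardCode R C?) ℚ./ card R) {{card-nonZero R}}) k
    → k ℤ.≤ (+ n) ℤ.- ℚ.⌈ ((+ (P ∸ 1)) ℚ./ P) ℚ.* (ℚ._÷_ d γ {{ℚP.pos⇒nonZero γ {{ℚ.positive γ>0}}}}) ⌉
theorem2 R frobenius w γ γ>0 w-hom n C C? C-lin d _ d≤ γn≤d (c′ , Cc′ , c′≢0 , c′<n) P (c , Cc , c<n , |Rc|≡P) |Rc|≤P k k-ceil =
  -- The index t separates the two sides: k ≤ t = n - (n - t) ≤ n - ⌈δ⌉. As n - t is an integer,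
  -- bounding δ by it also bounds its ceiling.
  ℤP.≤-trans k≤t (subst (ℤ._≤ (+ n) ℤ.- ℚ.⌈ δ ⌉) (n-[n-t] (+ n) (+ t))
    (ℤP.+-monoʳ-≤ (+ n) (ℤP.neg-mono-≤ (⌈⌉-≤ δ ((+ n) ℤ.- (+ t)) δ≤n-t))))
  where
  open Words R
  open FiniteGroupSums (wordGroup n)
  δ = ((+ (P ∸ 1)) ℚ./ P) * (ℚ._÷_ d γ {{ℚP.pos⇒nonZero γ {{ℚ.positive γ>0}}}})

  zeroOfc : ∃ λ j → FiniteRing._≈_ R (Vec.lookup c j) (FiniteRing.0# R)
  zeroOfc = hamming<n⇒zero c c<n
  j = proj₁ zeroOfc
  open Coordinate C? C-lin j

  Rc⊆VanishAt : InRc R c ⊆ VanishAt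
  Rc⊆VanishAt = InRc⊆C VanishAt-isLinear (Cc , proj₂ zeroOfc)

  quotient : ∃ λ t → count VanishAt? ≡ cardRc R c ℕ.* t
  quotient =
    lagrange (InRc? R c) (code⇒subgroup (InRc-isLinear c)) VanishAt? (code⇒subgroup VanishAt-isLinear) Rc⊆VanishAt
  t = proj₁ quotient
  N≡Pt : count VanishAt? ≡ P ℕ.* t
  N≡Pt = trans (proj₂ quotient) (cong (ℕ._* t) |Rc|≡P)

  2≤P : 2 ℕ.≤ P
  -- The word c is not given as nonzero; the lower bound comes from c′ through the maximality of P.
  2≤P = ℕP.≤-trans (cardRc≥2 c′≢0) (|Rc|≤P c′ Cc′ c′<n)

  1≤t : 1 ℕ.≤ t
  -- With t = 0 the subcode would be empty, although it contains the P elements of Rc.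
  1≤t = ℕP.n≢0⇒n>0 λ t≡0 → ℕP.<⇒≱ (ℕP.<-≤-trans (ℕ.s≤s ℕ.z≤n) 2≤P)
    (subst₂ ℕ._≤_ |Rc|≡P (trans N≡Pt (trans (cong (P ℕ.*_) t≡0) (ℕP.*-zeroʳ P)))
      (count-mono-≤ (InRc? R c) VanishAt? Rc⊆VanishAt))

  k≤t : k ℤ.≤ + t
  k≤t = ceilLog-≤ P k-ceil (ℚP.≤-trans
    (fraction-≤ {m = P ℕ.* t} {{card-nonZero R}} (subst (λ N → cardCode R C? ℕ.≤ N ℕ.* card R) N≡Pt cardCode≤))
    (ι-mono-≤ (m*n≤m^n P t 2≤P 1≤t)))

  δ≤n-t : δ ≤ fromℤ ((+ n) ℤ.- (+ t))
  δ≤n-t = scaled-distance-≤ γ>0 2≤P 1≤t γn≤d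
    (subst (λ N → ι N * d - d ≤ ι n * (γ * ι N) - γ * ι N) N≡Pt
      -- Plotkin is applied to the subcode, whose nonzero words inherit the lower bound d from C.
      (Plotkin.plotkin R frobenius w γ w-hom (ℚP.<⇒≤ γ>0) VanishAt? VanishAt-isLinear j (λ _ → proj₂)
        d (λ v (Cv , _) → d≤ v Cv)))

  n-[n-t] : ∀ a b → a ℤ.- (a ℤ.- b) ≡ b
  n-[n-t] = solve-∀
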